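{- For each integer $r\ge 2$ there are constants $0<c_r<C_r$ such that, for every integer $n\ge 2$, $$\frac{c_r}{n}\le \Delta_{\mathcal{PC}}(n)\le C_r\,\frac{\ln^{r-1}(n)}{n}.$$
   Context: For fixed $r\ge2$, $\mathcal{PC}$ is the set of $r$-tuples $\mathbf{x}=(x_1,\dots,x_r)$ of positive integers with $\gcd(x_i,x_j)=1$ for all $i\ne j$. For $n\ge1$ and $\boldsymbol{\alpha}=(\alpha_1,\dots,\alpha_r)\in[0,1]^r$ put $|\boldsymbol{\alpha}|=\alpha_1\cdots\alpha_r$ and $G(n,\boldsymbol{\alpha})=\#\{\mathbf{x}\in\mathcal{PC}: x_j\le n\alpha_j \text{ for } j=1,\dots,r\}$. With $\boldsymbol{1}=(1,\dots,1)$, the discrepancy function of $\mathcal{PC}$ is $$\Delta_{\mathcal{PC}}(n)=\sup_{\boldsymbol{\alpha}\in[0,1]^r}\bigg|\frac{G(n,\boldsymbol{\alpha})}{G(n,\boldsymbol{1})}-|\boldsymbol{\alpha}|\bigg|.$$ Here $\ln^{r-1}(n)=(\ln n)^{r-1}$. -}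

module Defs where

open import Algebra.Bundles using (CommutativeRing)
open import Data.Bool.Base using (if_then_else_)
open import Data.Fin.Base using (Fin; zero; suc; inject₁; fromℕ)
import Data.Fin.Properties as Fin
open import Data.List.Base using (List; [_]; map; upTo; filter; length; cartesianProductWith)
import Data.Nat.Base as ℕ
open import Data.Nat.Base using (ℕ)
open import Data.Nat.GCD using (gcd)
import Data.Nat.Properties as ℕ
open import Data.Product.Base using (_×_; ∃; ∃₂)
open import Data.Vec.Base using (Vec; []; _∷_; lookup)
open import Data.Vec.Functional using (Vector)
open import Level using (0ℓ)
import Relation.Binary.Construct.NonStrictToStrict as NonStrictToStrict
open import Relation.Binary.Core using (Rel)
open import Relation.Binary.PropositionalEquality.Core using (_≡_; _≢_)
open import Relation.Binary.Structures using (IsDecTotalOrder)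
open import Relation.Nullary.Decidable using (does; ¬?; _×-dec_; _→-dec_)
open import Relation.Nullary.Negation using (¬_)
open import Relation.Unary using (Pred; Decidable; Satisfiable)

-- The real numbers enter axiomatically, as an arbitrary Dedekind-complete
-- ordered field (classically unique up to isomorphism).  The operations
-- _⁻¹ and sup are total, but nothing is assumed about the inverse of 0 or
-- about the supremum of an empty or unbounded set.
record CompleteOrderedField : Set₁ where
  infix 4 _≤_
  infix 8 _⁻¹
  field
    commutativeRing : CommutativeRing 0ℓ 0ℓ

  open CommutativeRing commutativeRing public
    renaming (Carrier to ℝ; zero to *-zero)

  field
    _≤_             : Rel ℝ 0ℓ
    isDecTotalOrder : IsDecTotalOrder _≈_ _≤_
    0≉1             : ¬ (0# ≈ 1#)
    +-monoˡ-≤       : ∀ {x y} z → x ≤ y → x + z ≤ y + z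
    *-nonneg        : ∀ {x y} → 0# ≤ x → 0# ≤ y → 0# ≤ x * y
    _⁻¹             : ℝ → ℝ
    *-inverseʳ      : ∀ x → ¬ (x ≈ 0#) → x * x ⁻¹ ≈ 1#

  IsUpperBound : Pred ℝ 0ℓ → ℝ → Set
  IsUpperBound P b = ∀ {x} → P x → x ≤ b

  field
    sup       : Pred ℝ 0ℓ → ℝ
    sup-upper : ∀ P → Satisfiable P → ∃ (IsUpperBound P) → IsUpperBound P (sup P)
    sup-least : ∀ P → Satisfiable P → ∀ b → IsUpperBound P b → sup P ≤ b

  open IsDecTotalOrder isDecTotalOrder public using (_≤?_)
  open NonStrictToStrict _≈_ _≤_ public using (_<_)

IsPC : ∀ {r} → Pred (Vec ℕ r) 0ℓ
IsPC x = (∀ i → 1 ℕ.≤ lookup x i)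
       × (∀ i j → i ≢ j → gcd (lookup x i) (lookup x j) ≡ 1)

isPC? : ∀ {r} → Decidable (IsPC {r})
isPC? x =
  Fin.all? (λ i → 1 ℕ.≤? lookup x i) ×-dec
  Fin.all? (λ i → Fin.all? (λ j →
    ¬? (i Fin.≟ j) →-dec (gcd (lookup x i) (lookup x j) ℕ.≟ 1)))

-- All r-tuples with entries in {1,…,n}, each listed exactly once.
box : (r n : ℕ) → List (Vec ℕ r)
box ℕ.zero    n = [ [] ]
box (ℕ.suc r) n = cartesianProductWith _∷_ (map ℕ.suc (upTo n)) (box r n)

module Real (𝓡 : CompleteOrderedField) where
  open CompleteOrderedField 𝓡 public

  open import Algebra.Properties.Monoid.Mult +-monoid
    using () renaming (_×_ to _·_)
  open import Algebra.Properties.CommutativeMonoid.Sum +-commutativeMonoid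
    using (sum)
  open import Algebra.Properties.CommutativeMonoid.Sum *-commutativeMonoid
    using () renaming (sum to product)
  open import Algebra.Properties.Semiring.Exp semiring public using (_^_)

  infixl 7 _/_

  ι : ℕ → ℝ
  ι n = n · 1#

  _/_ : ℝ → ℝ → ℝ
  x / y = x * y ⁻¹

  ∣_∣ : ℝ → ℝ
  ∣ x ∣ = if does (0# ≤? x) then x else - x

  record Partition (a b : ℝ) (m : ℕ) : Set where
    field
      point    : Vector ℝ (ℕ.suc m)
      start    : point zero ≈ a
      end      : point (fromℕ m) ≈ b
      monotone : ∀ i → point (inject₁ i) ≤ point (suc i)

  open Partition

  -- Since t ↦ 1/t decreases, its infimum over [tᵢ , tᵢ₊₁] is 1/tᵢ₊₁.
  lowerSum : ∀ {a b m} → Partition a b m → ℝ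
  lowerSum p = sum (λ i → (point p (suc i) - point p (inject₁ i)) / point p (suc i))

  -- ln x = ∫₁ˣ dt/t as the supremum of the lower Darboux sums; only
  -- meaningful for x ≥ 1.
  ln : ℝ → ℝ
  ln x = sup (λ y → ∃₂ λ m (p : Partition 1# x m) → y ≈ lowerSum p)

  InUnitCube : ∀ {r} → Pred (Vector ℝ r) 0ℓ
  InUnitCube α = ∀ j → 0# ≤ α j × α j ≤ 1#

  𝟏 : ∀ {r} → Vector ℝ r
  𝟏 _ = 1#

  volume : ∀ {r} → Vector ℝ r → ℝ
  volume = product

  Counted : ∀ {r} → ℕ → Vector ℝ r → Pred (Vec ℕ r) 0ℓ
  Counted n α x = IsPC x × (∀ j → ι (lookup x j) ≤ ι n * α j)

  counted? : ∀ {r} n (α : Vector ℝ r) → Decidable (Counted n α)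
  counted? n α x =
    isPC? x ×-dec Fin.all? (λ j → ι (lookup x j) ≤? ι n * α j)

  -- For α in the unit cube, Counted n α x forces 1 ≤ x j ≤ n for every j,
  -- so it suffices to search box r n.
  G : ∀ {r} → ℕ → Vector ℝ r → ℕ
  G {r} n α = length (filter (counted? n α) (box r n))

  Δ-PC : (r n : ℕ) → ℝ
  Δ-PC r n = sup (λ y → ∃ λ (α : Vector ℝ r) → InUnitCube α ×
    y ≈ ∣ ι (G n α) / ι (G {r} n 𝟏) - volume α ∣)

{-# OPTIONS --safe #-}
-- For m ≤ n, summing over the other entries u = x₂⋯xᵣ gives
--   G(m, m₂, …) = Σ Φ(u, m)  with  Φ(u, m) = #{x ≤ m : gcd(x, u) = 1},
-- and sieving by the primes of u shows |n Φ(u, m) - m Φ(u, n)| ≤ 2 n τ(u).  As τ is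
-- submultiplicative along the sieve, replacing m by n in one coordinate costs
-- O((Σ_{x ≤ n} τ(x))^(r-1)) = O((n ln n)^(r-1)); replacing the coordinates one at a time
-- compares G(m₁, …, mᵣ) with (m₁⋯mᵣ/nʳ) G(n, …, n).  No asymptotic constant for G(n, 1) is
-- needed, only G(n, 1) ≫ nʳ: among the x ≡ 1 mod K!, two distinct entries share only
-- divisors g > K that divide their difference, so few pairs fail to be coprime.
-- The lower bound comes from α = (1/(2n), 1, …, 1), which counts nothing.
module Submission where

open import Defs
open import Data.Nat.Base using (ℕ) renaming (_≤_ to _≤ℕ_; _∸_ to _∸ℕ_)
open import Data.Product.Base using (_×_; ∃₂)

import Algebra.Properties.AbelianGroup
import Algebra.Properties.CommutativeMonoid.Sum
import Algebra.Properties.CommutativeSemiring.Exp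
import Algebra.Properties.Monoid.Mult
import Algebra.Properties.Ring
import Algebra.Properties.Semiring.Mult
import Algebra.Solver.Ring.NaturalCoefficients.Default as SemiringSolver
open import Data.Fin.Base using (Fin; zero; suc; inject₁; fromℕ; toℕ)
open import Data.Fin.Properties using (toℕ-fromℕ; toℕ-inject₁)
import Data.Nat.Base as ℕ
open import Data.Nat.Base using (zero; suc)
open import Data.Nat.Coprimality as Coprime
  using (Coprime; coprime?; coprime-divisor; coprime⇒gcd≡1; gcd≡1⇒coprime)
open import Data.Nat.Divisibility
open import Data.Nat.ListAction using (product)
import Data.Nat.Properties as ℕ
open import Data.Nat.Tactic.RingSolver using (solve-∀)
open import Data.Product.Base using (∃; _,_; proj₁; proj₂)
open import Data.Sum.Base using (_⊎_; inj₁; inj₂)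
open import Data.Vec.Base using (Vec; []; _∷_; lookup; tabulate; replicate)
open import Data.Vec.Functional using (Vector)
open import Data.Vec.Properties using (lookup∘tabulate; lookup-replicate)
open import Data.Vec.Relation.Unary.All using (All; []; _∷_)
open import Data.Vec.Relation.Unary.All.Properties using (tabulate⁺)
open import Function.Base using (_∘_; const)
open import Level using (0ℓ)
open import Relation.Binary.Bundles using (Poset)
import Relation.Binary.PropositionalEquality as ≡
open import Relation.Binary.PropositionalEquality using (_≡_; _≢_)
import Relation.Binary.Reasoning.PartialOrder as PartialOrderReasoning
open import Relation.Binary.Structures using (IsDecTotalOrder)
open import Relation.Nullary.Decidable.Core using (Dec; yes; no; does; ¬?; _×-dec_)
open import Relation.Nullary.Negation using (¬_; contradiction)
open import Relation.Unary using (Pred; Decidable)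

-- Three choices shape the proof. Comparisons between counts are cross-multiplied, one-sided
-- inequalities in natural numbers, valid for any two arguments; the opposite bound is the same
-- statement with the arguments exchanged. Each new prime of u doubles the sieve error, so the true
-- loss is 2^ω(u). It is replaced by τ(u), which grows at least as fast when a prime is added and
-- whose sum up to n is at most n times a harmonic number, by exchanging two sums. Dividing the
-- error (n ln n)^(r-1) by a count of order n^r leaves the claimed quotient. For the density a union
-- bound over all tuples is useless: the pairs of even entries alone account for about r(r-1)/8 of
-- them, more than 1 from r = 4 on. In the progression the clashing pairs have proportion O(1/K),
-- because the sum of 1/g² over g > K is at most 1/K, and a `K` proportional to r² beats the number
-- of pairs. The supremum runs over real `α`, but `G` sees only the integer parts of n α_j; rounding
-- changes the volume by at most r/n, which the error term absorbs.

module Counting where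

  open import Data.Bool.Base using (if_then_else_)
  open import Data.Fin.Properties using (suc-injective)
  open import Data.List.Base
    using (List; []; _∷_; map; upTo; filter; length; _++_; _∷ʳ_; cartesianProductWith)
  open import Data.List.Properties
    using (filter-++; length-++; filter-none; map-++; upTo-∷ʳ; ++-assoc; ++-identityʳ)
  open import Data.List.Relation.Unary.All as List using ([]; _∷_)
  open import Data.Nat.Base
  open import Data.Nat.DivMod
    using (m≡m%n+[m/n]*n; m%n<n; m/n*n≤m; m/n/o≡m/[n*o]; m*n/n≡m; n/1≡n; /-congˡ)
  open import Data.Nat.GCD using (gcd; gcd[m,n]∣m; gcd[m,n]∣n)
  open import Data.Nat.Primality
  open import Data.Nat.Primality.Factorisation using (factorise)
  open import Data.Nat.Properties hiding (suc-injective)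
  open import Data.Unit.Base using (⊤; tt)
  open import Relation.Binary.Definitions using (tri<; tri≈; tri>)
  open import Relation.Binary.PropositionalEquality hiding ([_])

  -- Indicators and finite sums of natural numbers

  𝟙 : ∀ {P : Set} → Dec P → ℕ
  𝟙 P? = if does P? then 1 else 0

  𝟙-yes : ∀ {P : Set} (P? : Dec P) → P → 𝟙 P? ≡ 1
  𝟙-yes (yes _) p = refl
  𝟙-yes (no ¬p) p = contradiction p ¬p

  𝟙-no : ∀ {P : Set} (P? : Dec P) → ¬ P → 𝟙 P? ≡ 0
  𝟙-no (yes p) ¬p = contradiction p ¬p
  𝟙-no (no _)  ¬p = refl

  𝟙≤1 : ∀ {P : Set} (P? : Dec P) → 𝟙 P? ≤ 1
  𝟙≤1 (yes _) = ≤-refl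
  𝟙≤1 (no _)  = z≤n

  𝟙-mono : ∀ {P Q : Set} (P? : Dec P) (Q? : Dec Q) → (P → Q) → 𝟙 P? ≤ 𝟙 Q?
  𝟙-mono (yes p) Q? f = ≤-reflexive (sym (𝟙-yes Q? (f p)))
  𝟙-mono (no _)  Q? f = z≤n

  𝟙-cong : ∀ {P Q : Set} (P? : Dec P) (Q? : Dec Q) → (P → Q) → (Q → P) → 𝟙 P? ≡ 𝟙 Q?
  𝟙-cong P? Q? f g = ≤-antisym (𝟙-mono P? Q? f) (𝟙-mono Q? P? g)

  𝟙-× : ∀ {P Q : Set} (P? : Dec P) (Q? : Dec Q) → 𝟙 P? * 𝟙 Q? ≡ 𝟙 (P? ×-dec Q?)
  𝟙-× (no _)  Q?      = refl
  𝟙-× (yes _) (no _)  = refl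
  𝟙-× (yes _) (yes _) = refl

  𝟙-¬ : ∀ {P : Set} (P? : Dec P) → 𝟙 P? + 𝟙 (¬? P?) ≡ 1
  𝟙-¬ (yes _) = refl
  𝟙-¬ (no _)  = refl

  ∑ : ℕ → (ℕ → ℕ) → ℕ
  ∑ zero    f = 0
  ∑ (suc n) f = ∑ n f + f (suc n)

  infixr 6.5 ∑
  syntax ∑ n (λ x → e) = ∑[ x ≤ n ] e

  ∑-mono-≤ : ∀ n {f g : ℕ → ℕ} → (∀ x → 1 ≤ x → x ≤ n → f x ≤ g x) → ∑ n f ≤ ∑ n g
  ∑-mono-≤ zero    f≤g = z≤n
  ∑-mono-≤ (suc n) f≤g =
    +-mono-≤ (∑-mono-≤ n λ x 1≤x x≤n → f≤g x 1≤x (m≤n⇒m≤1+n x≤n)) (f≤g (suc n) (s≤s z≤n) ≤-refl)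

  ∑-mono : ∀ n {f g : ℕ → ℕ} → (∀ x → f x ≤ g x) → ∑ n f ≤ ∑ n g
  ∑-mono n f≤g = ∑-mono-≤ n λ x _ _ → f≤g x

  ∑-cong : ∀ n {f g : ℕ → ℕ} → (∀ x → f x ≡ g x) → ∑ n f ≡ ∑ n g
  ∑-cong zero    f≡g = refl
  ∑-cong (suc n) f≡g = cong₂ _+_ (∑-cong n f≡g) (f≡g (suc n))

  ∑-const : ∀ n k → ∑[ _ ≤ n ] k ≡ n * k
  ∑-const zero    k = refl
  ∑-const (suc n) k = trans (cong (_+ k) (∑-const n k)) (+-comm (n * k) k)

  ∑-distrib-+ : ∀ n (f g : ℕ → ℕ) → ∑[ x ≤ n ] (f x + g x) ≡ ∑ n f + ∑ n g
  ∑-distrib-+ zero    f g = refl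
  ∑-distrib-+ (suc n) f g rewrite ∑-distrib-+ n f g = lemma (∑ n f) (∑ n g) (f (suc n)) (g (suc n))
    where
    lemma : ∀ a b c d → a + b + (c + d) ≡ a + c + (b + d)
    lemma = solve-∀

  *-distribˡ-∑ : ∀ n k (f : ℕ → ℕ) → ∑[ x ≤ n ] k * f x ≡ k * ∑ n f
  *-distribˡ-∑ zero    k f = sym (*-zeroʳ k)
  *-distribˡ-∑ (suc n) k f rewrite *-distribˡ-∑ n k f = sym (*-distribˡ-+ k _ _)

  *-distribʳ-∑ : ∀ n k (f : ℕ → ℕ) → ∑[ x ≤ n ] f x * k ≡ ∑ n f * k
  *-distribʳ-∑ n k f = trans (∑-cong n λ x → *-comm (f x) k) (trans (*-distribˡ-∑ n k f) (*-comm k _))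

  ∑-swap : ∀ m n (f : ℕ → ℕ → ℕ) → ∑[ x ≤ m ] ∑[ y ≤ n ] f x y ≡ ∑[ y ≤ n ] ∑[ x ≤ m ] f x y
  ∑-swap zero    n f = sym (trans (∑-const n 0) (*-zeroʳ n))
  ∑-swap (suc m) n f rewrite ∑-swap m n f = sym (∑-distrib-+ n _ _)

  ∑-monoˡ-≤ : ∀ {m n} (f : ℕ → ℕ) → m ≤ n → ∑ m f ≤ ∑ n f
  ∑-monoˡ-≤ f m≤n = go (≤⇒≤′ m≤n)
    where
    go : ∀ {m n} → m ≤′ n → ∑ m f ≤ ∑ n f
    go ≤′-refl       = ≤-refl
    go (≤′-step m≤n) = ≤-trans (go m≤n) (m≤m+n _ _)

  f≤∑f : ∀ {n x} (f : ℕ → ℕ) → 1 ≤ x → x ≤ n → f x ≤ ∑ n f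
  f≤∑f {x = suc x} f _ x≤n = ≤-trans (m≤n+m _ _) (∑-monoˡ-≤ f x≤n)

  ∑-suc : ∀ n (f : ℕ → ℕ) → ∑ (suc n) f ≡ f 1 + ∑ n (f ∘ suc)
  ∑-suc zero    f = sym (+-identityʳ (f 1))
  ∑-suc (suc n) f rewrite ∑-suc n f = +-assoc (f 1) _ _

  ∣m+n∣n⇒∣m : ∀ {i m n} → i ∣ m + n → i ∣ n → i ∣ m
  ∣m+n∣n⇒∣m {i} {m} {n} i∣m+n = ∣m+n∣m⇒∣n (subst (i ∣_) (+-comm m n) i∣m+n)

  -- With the upper limit written as `s + q * p`, terms are peeled off the top without division: a
  -- positive remainder `s` means a non-multiple, and remainder 0 means the multiple `suc q * p`,
  -- after which the remainder restarts at `p-1`.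
  ∑-multiples : ∀ p .{{_ : NonZero p}} m (h : ℕ → ℕ) →
                ∑[ x ≤ m ] 𝟙 (p ∣? x) * h x ≡ ∑[ y ≤ m / p ] h (p * y)
  ∑-multiples p@(suc p-1) m h =
    trans (cong (λ m → ∑[ x ≤ m ] 𝟙 (p ∣? x) * h x) (m≡m%n+[m/n]*n m p)) (go (m % p) (m / p) (m%n<n m p))
    where
    go : ∀ s q → s < p → ∑[ x ≤ s + q * p ] 𝟙 (p ∣? x) * h x ≡ ∑[ y ≤ q ] h (p * y)
    go zero    zero    _   = refl
    go zero    (suc q) _   = cong₂ _+_ (go p-1 q ≤-refl)
      (trans (cong₂ _*_ (𝟙-yes (p ∣? (suc q * p)) (n∣m*n (suc q))) (cong h (*-comm (suc q) p)))
             (+-identityʳ _))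
    go (suc s) q       s<p
      rewrite 𝟙-no (p ∣? (suc s + q * p)) (λ p∣ → <⇒≱ s<p (∣⇒≤ (∣m+n∣n⇒∣m p∣ (n∣m*n q))))
      = trans (+-identityʳ _) (go s q (<-trans (n<1+n s) s<p))

  ∑-progression : ∀ p .{{_ : NonZero p}} m (h : ℕ → ℕ) →
                  ∑[ y ≤ m / p ] h (p * y) ≤ ∑ m h
  ∑-progression p m h = ≤-trans (≤-reflexive (sym (∑-multiples p m h)))
    (∑-mono m λ x → ≤-trans (*-monoˡ-≤ (h x) (𝟙≤1 (p ∣? x))) (≤-reflexive (+-identityʳ (h x))))

  -- Counting integers coprime to u

  coprime-*⁺ : ∀ {u v x} → Coprime u x → Coprime v x → Coprime (u * v) x
  coprime-*⁺ u⊥x v⊥x (i∣uv , i∣x) =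
    v⊥x (coprime-divisor (λ (j∣i , j∣u) → u⊥x (j∣u , ∣-trans j∣i i∣x)) i∣uv , i∣x)

  coprime-∣ˡ : ∀ {u v x} → v ∣ u → Coprime u x → Coprime v x
  coprime-∣ˡ v∣u u⊥x (i∣v , i∣x) = u⊥x (∣-trans i∣v v∣u , i∣x)

  coprime-∣ʳ : ∀ {u x y} → y ∣ x → Coprime u x → Coprime u y
  coprime-∣ʳ y∣x u⊥x (i∣u , i∣y) = u⊥x (i∣u , ∣-trans i∣y y∣x)

  prime∤⇒coprime : ∀ {p n} → Prime p → ¬ p ∣ n → Coprime p n
  prime∤⇒coprime p-prime p∤n (i∣p , i∣n) with prime⇒irreducible p-prime i∣p
  ... | inj₁ i≡1  = i≡1
  ... | inj₂ refl = contradiction i∣n p∤n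

  ⊥? : ℕ → ℕ → ℕ
  ⊥? u x = 𝟙 (coprime? u x)

  -- Either product indicates that `x` and `y` are coprime to `u` and to each other, a condition
  -- symmetric in `x` and `y`.
  ⊥?-exchange : ∀ u x y → ⊥? u x * ⊥? (u * x) y ≡ ⊥? u y * ⊥? (u * y) x
  ⊥?-exchange u x y = trans (𝟙-× (coprime? u x) (coprime? (u * x) y)) (trans
    (𝟙-cong (coprime? u x ×-dec coprime? (u * x) y) (coprime? u y ×-dec coprime? (u * y) x) exch exch)
    (sym (𝟙-× (coprime? u y) (coprime? (u * y) x))))
    where
    exch : ∀ {x y} → Coprime u x × Coprime (u * x) y → Coprime u y × Coprime (u * y) x
    exch {x} (u⊥x , ux⊥y) =
      coprime-∣ˡ (m∣m*n x) ux⊥y , coprime-*⁺ u⊥x (Coprime.sym (coprime-∣ˡ (n∣m*n u) ux⊥y))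

  Φ : ℕ → ℕ → ℕ
  Φ u m = ∑ m (⊥? u)

  Φ-prime∣ : ∀ {p w} m → p ∣ w → Φ (p * w) m ≡ Φ w m
  Φ-prime∣ {p} {w} m p∣w = ∑-cong m λ x → 𝟙-cong (coprime? (p * w) x) (coprime? w x)
    (coprime-∣ˡ (n∣m*n p)) (λ w⊥x → coprime-*⁺ (coprime-∣ˡ p∣w w⊥x) w⊥x)

  -- One step of Legendre's sieve: the numbers to remove are `p * y`, and since `p` is itself
  -- coprime to `w`, such a number is coprime to `w` exactly when `y` is.
  Φ-prime∤ : ∀ {p w} → Prime p → ¬ p ∣ w → .{{_ : NonZero p}} → ∀ m →
             Φ w m ≡ Φ (p * w) m + Φ w (m / p)
  Φ-prime∤ {p} {w} p-prime p∤w m = begin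
    ∑[ x ≤ m ] ⊥? w x
      ≡⟨ ∑-cong m split ⟩
    ∑[ x ≤ m ] (⊥? (p * w) x + 𝟙 (p ∣? x) * ⊥? w x)
      ≡⟨ ∑-distrib-+ m _ _ ⟩
    Φ (p * w) m + ∑[ x ≤ m ] 𝟙 (p ∣? x) * ⊥? w x
      ≡⟨ cong (Φ (p * w) m +_) (∑-multiples p m (⊥? w)) ⟩
    Φ (p * w) m + ∑[ y ≤ m / p ] ⊥? w (p * y)
      ≡⟨ cong (Φ (p * w) m +_) (∑-cong (m / p) λ y → 𝟙-cong (coprime? w (p * y)) (coprime? w y)
           (coprime-∣ʳ (n∣m*n p)) (λ w⊥y → Coprime.sym (coprime-*⁺ p⊥w (Coprime.sym w⊥y)))) ⟩
    Φ (p * w) m + Φ w (m / p) ∎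
    where
    open ≡-Reasoning
    p⊥w : Coprime p w
    p⊥w = prime∤⇒coprime p-prime p∤w
    split : ∀ x → ⊥? w x ≡ ⊥? (p * w) x + 𝟙 (p ∣? x) * ⊥? w x
    split x with p ∣? x
    ... | yes p∣x rewrite 𝟙-no (coprime? (p * w) x)
                            (λ pw⊥x → ¬prime[1] (subst Prime (pw⊥x (m∣m*n w , p∣x)) p-prime))
        = sym (+-identityʳ _)
    ... | no p∤x = trans
      (𝟙-cong (coprime? w x) (coprime? (p * w) x) (coprime-*⁺ (prime∤⇒coprime p-prime p∤x)) (coprime-∣ˡ (n∣m*n p)))
      (sym (+-identityʳ _))

  τ : ℕ → ℕ
  τ v = ∑[ d ≤ v ] 𝟙 (d ∣? v)

  τ-mono-∣ : ∀ {v w} .{{_ : NonZero w}} → v ∣ w → τ v ≤ τ w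
  τ-mono-∣ {v} {w} v∣w = ≤-trans
    (∑-mono v λ d → 𝟙-mono (d ∣? v) (d ∣? w) (λ d∣v → ∣-trans d∣v v∣w))
    (∑-monoˡ-≤ _ (∣⇒≤ v∣w))

  -- The divisors `d` of `v` and their multiples `p * d` all divide `p * v`, and no number is of
  -- both kinds because `p` does not divide `v`.
  τ-prime∤ : ∀ {p v} .{{_ : NonZero p}} .{{_ : NonZero v}} → ¬ p ∣ v → τ v * 2 ≤ τ (p * v)
  τ-prime∤ {p} {v} p∤v = begin
    τ v * 2
      ≡⟨ double (τ v) ⟩
    τ v + τ v
      ≤⟨ +-mono-≤ (∑-monoˡ-≤ _ (m≤n*m v p))
           (∑-mono v λ d → 𝟙-mono (d ∣? v) (p * d ∣? p * v) (*-monoʳ-∣ p)) ⟩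
    (∑[ e ≤ p * v ] 𝟙 (e ∣? v)) + (∑[ d ≤ v ] 𝟙 (p * d ∣? p * v))
      ≡⟨ cong (λ q → (∑[ e ≤ p * v ] 𝟙 (e ∣? v)) + (∑[ d ≤ q ] 𝟙 (p * d ∣? p * v)))
           (sym (trans (/-congˡ {o = p} (*-comm p v)) (m*n/n≡m v p))) ⟩
    (∑[ e ≤ p * v ] 𝟙 (e ∣? v)) + (∑[ d ≤ p * v / p ] 𝟙 (p * d ∣? p * v))
      ≡⟨ cong ((∑[ e ≤ p * v ] 𝟙 (e ∣? v)) +_) (sym (∑-multiples p (p * v) (λ e → 𝟙 (e ∣? p * v)))) ⟩
    (∑[ e ≤ p * v ] 𝟙 (e ∣? v)) + (∑[ e ≤ p * v ] 𝟙 (p ∣? e) * 𝟙 (e ∣? p * v))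
      ≡⟨ sym (∑-distrib-+ (p * v) _ _) ⟩
    ∑[ e ≤ p * v ] (𝟙 (e ∣? v) + 𝟙 (p ∣? e) * 𝟙 (e ∣? p * v))
      ≤⟨ ∑-mono (p * v) disjoint ⟩
    τ (p * v) ∎
    where
    open ≤-Reasoning
    double : ∀ x → x * 2 ≡ x + x
    double = solve-∀
    disjoint : ∀ e → 𝟙 (e ∣? v) + 𝟙 (p ∣? e) * 𝟙 (e ∣? p * v) ≤ 𝟙 (e ∣? p * v)
    disjoint e with p ∣? e
    ... | yes p∣e rewrite 𝟙-no (e ∣? v) (λ e∣v → p∤v (∣-trans p∣e e∣v)) = ≤-reflexive (+-identityʳ _)
    ... | no  _   = ≤-trans (≤-reflexive (+-identityʳ _)) (𝟙-mono (e ∣? v) (e ∣? p * v) (∣n⇒∣m*n p))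

  -- The arguments are rationals a / b, so that the sieve step Φ u t - Φ u (t / p) stays
  -- within the same class of hypotheses and no rounding error accumulates.
  Equidistributed : ℕ → ℕ → Set
  Equidistributed u e = ∀ b .{{_ : NonZero b}} a a′ →
    a′ * Φ u (a / b) ≤ a * Φ u (a′ / b) + (a + a′) * e

  equidistributed-mono : ∀ {u e e′} → e ≤ e′ → Equidistributed u e → Equidistributed u e′
  equidistributed-mono e≤e′ E b a a′ =
    ≤-trans (E b a a′) (+-monoʳ-≤ (a * _) (*-monoʳ-≤ (a + a′) e≤e′))

  Φ-1 : ∀ m → Φ 1 m ≡ m
  Φ-1 m = trans (∑-cong m λ x → 𝟙-yes (coprime? 1 x) (∣1⇒≡1 ∘ proj₁)) (trans (∑-const m 1) (*-identityʳ m))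

  -- Multiplying by `b` removes both floors: `a / b * b` is at most `a`, and `a′` exceeds
  -- `a′ / b * b` by less than `b`. This costs only `a`; adding `a′` makes the error symmetric.
  equidistributed-1 : Equidistributed 1 1
  equidistributed-1 b a a′ rewrite Φ-1 (a / b) | Φ-1 (a′ / b) = *-cancelʳ-≤ _ _ b (begin
    a′ * (a / b) * b                     ≡⟨ *-assoc a′ (a / b) b ⟩
    a′ * (a / b * b)                     ≤⟨ *-monoʳ-≤ a′ (m/n*n≤m a b) ⟩
    a′ * a                               ≡⟨ cong (_* a) (m≡m%n+[m/n]*n a′ b) ⟩
    (a′ % b + a′ / b * b) * a            ≤⟨ *-monoˡ-≤ a (+-monoˡ-≤ (a′ / b * b) (<⇒≤ (m%n<n a′ b))) ⟩
    (b + a′ / b * b) * a                 ≤⟨ m≤m+n _ _ ⟩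
    (b + a′ / b * b) * a + a′ * b        ≡⟨ rearrange b (a′ / b) a a′ ⟩
    (a * (a′ / b) + (a + a′) * 1) * b    ∎)
    where
    open ≤-Reasoning
    rearrange : ∀ b q a a′ → (b + q * b) * a + a′ * b ≡ (a * q + (a + a′) * 1) * b
    rearrange = solve-∀

  -- The sieve writes the new count as a difference. The first term is bounded by the hypothesis at
  -- denominator `b`; the subtracted one needs the opposite inequality, which is the hypothesis at
  -- denominator `b * p` with `a` and `a′` exchanged. Two uses double the error.
  equidistributed-prime∤ : ∀ {p u e} → Prime p → ¬ p ∣ u →
                           Equidistributed u e → Equidistributed (p * u) (e * 2)
  equidistributed-prime∤ {p} {u} {e} p-prime p∤u E b a a′ =
    +-cancelʳ-≤ (a′ * Φ u (a / (b * p))) _ _ (begin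
      a′ * Φ (p * u) (a / b) + a′ * Φ u (a / (b * p))
        ≡⟨ sieve a a′ ⟨
      a′ * Φ u (a / b)
        ≤⟨ E b a a′ ⟩
      a * Φ u (a′ / b) + (a + a′) * e
        ≡⟨ cong (_+ (a + a′) * e) (sieve a′ a) ⟩
      a * Φ (p * u) (a′ / b) + a * Φ u (a′ / (b * p)) + (a + a′) * e
        ≤⟨ +-monoˡ-≤ _ (+-monoʳ-≤ (a * Φ (p * u) (a′ / b)) (E (b * p) a′ a)) ⟩
      a * Φ (p * u) (a′ / b) + (a′ * Φ u (a / (b * p)) + (a′ + a) * e) + (a + a′) * e
        ≡⟨ rearrange (a * Φ (p * u) (a′ / b)) (a′ * Φ u (a / (b * p))) a a′ e ⟩
      a * Φ (p * u) (a′ / b) + (a + a′) * (e * 2) + a′ * Φ u (a / (b * p)) ∎)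
    where
    open ≤-Reasoning
    instance
      p≢0 : NonZero p
      p≢0 = prime⇒nonZero p-prime
      bp≢0 : NonZero (b * p)
      bp≢0 = m*n≢0 b p
    sieve : ∀ a a′ → a′ * Φ u (a / b) ≡ a′ * Φ (p * u) (a / b) + a′ * Φ u (a / (b * p))
    sieve a a′ = trans
      (cong (a′ *_) (trans (Φ-prime∤ p-prime p∤u (a / b))
                           (cong (λ q → Φ (p * u) (a / b) + Φ u q) (m/n/o≡m/[n*o] a b p))))
      (*-distribˡ-+ a′ _ _)
    rearrange : ∀ x y a a′ e → x + (y + (a′ + a) * e) + (a + a′) * e ≡ x + (a + a′) * (e * 2) + y
    rearrange = solve-∀

  -- Induction over the prime factors of `v`. A prime that already divides the modulus leaves `Φ`
  -- unchanged while `τ` does not drop; a new prime doubles the error, and `τ` at least doubles as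
  -- well.
  equidistributed-* : ∀ {u e} v .{{_ : NonZero v}} → Equidistributed u e → Equidistributed (u * v) (e * τ v)
  equidistributed-* {u} {e} v E with factorise v
  ... | record { factors = ps ; isFactorisation = refl ; factorsPrime = ps-prime } = go ps ps-prime
    where
    go : ∀ ps → List.All Prime ps → Equidistributed (u * product ps) (e * τ (product ps))
    go []       []                   = subst₂ Equidistributed (sym (*-identityʳ u)) (sym (*-identityʳ e)) E
    go (p ∷ ps) (p-prime ∷ ps-prime) =
      subst (λ w → Equidistributed w (e * τ (p * product ps))) (swap p u (product ps)) step
      where
      instance
        p≢0 : NonZero p
        p≢0 = prime⇒nonZero p-prime
        ps≢0 : NonZero (product ps)
        ps≢0 = productOfPrimes≢0 ps-prime
        pps≢0 : NonZero (p * product ps)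
        pps≢0 = m*n≢0 p (product ps)
      swap : ∀ p u v → p * (u * v) ≡ u * (p * v)
      swap = solve-∀
      step : Equidistributed (p * (u * product ps)) (e * τ (p * product ps))
      step with p ∣? u * product ps
      ... | yes p∣w = λ b a a′ → subst₂ (λ x y → a′ * x ≤ a * y + (a + a′) * (e * τ (p * product ps)))
            (sym (Φ-prime∣ (a / b) p∣w)) (sym (Φ-prime∣ (a′ / b) p∣w))
            (equidistributed-mono {u * product ps} (*-monoʳ-≤ e (τ-mono-∣ (n∣m*n p))) (go ps ps-prime) b a a′)
      ... | no p∤w = equidistributed-mono {p * (u * product ps)}
            (≤-trans (≤-reflexive (*-assoc e _ 2)) (*-monoʳ-≤ e (τ-prime∤ {p} (λ p∣v → p∤w (∣n⇒∣m*n u p∣v)))))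
            (equidistributed-prime∤ {p} {u * product ps} p-prime p∤w (go ps ps-prime))

  -- Counting pairwise coprime tuples

  -- The sum of K (u x₁ ⋯ xᵣ) over the pairwise coprime x ≤ ms with all entries coprime to u.
  coprimeSum : ∀ {r} → ℕ → Vec ℕ r → (ℕ → ℕ) → ℕ
  coprimeSum u []       K = K u
  coprimeSum u (m ∷ ms) K = ∑[ x ≤ m ] ⊥? u x * coprimeSum (u * x) ms K

  coprimeCount : ∀ {r} → ℕ → Vec ℕ r → ℕ
  coprimeCount u ms = coprimeSum u ms (const 1)

  ∏ : ∀ {r} → Vec ℕ r → ℕ
  ∏ []       = 1
  ∏ (m ∷ ms) = m * ∏ ms

  -- Swapping neighbouring coordinates moves the first one past all others. Summed innermost, it
  -- sees only the product of the rest and becomes a value of `Φ`, to which equidistribution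
  -- applies.
  coprimeCount-∷ : ∀ {r} u m (ms : Vec ℕ r) →
                   coprimeCount u (m ∷ ms) ≡ coprimeSum u ms (λ w → Φ w m)
  coprimeCount-∷ u m []       = ∑-cong m λ x → *-identityʳ (⊥? u x)
  coprimeCount-∷ u m (n ∷ ns) = begin
    ∑[ x ≤ m ] ⊥? u x * (∑[ y ≤ n ] ⊥? (u * x) y * g (u * x * y))
      ≡⟨ ∑-cong m (λ x → sym (*-distribˡ-∑ n (⊥? u x) _)) ⟩
    ∑[ x ≤ m ] ∑[ y ≤ n ] ⊥? u x * (⊥? (u * x) y * g (u * x * y))
      ≡⟨ ∑-cong m (λ x → ∑-cong n (exchange x)) ⟩
    ∑[ x ≤ m ] ∑[ y ≤ n ] ⊥? u y * (⊥? (u * y) x * g (u * y * x))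
      ≡⟨ ∑-swap m n _ ⟩
    ∑[ y ≤ n ] ∑[ x ≤ m ] ⊥? u y * (⊥? (u * y) x * g (u * y * x))
      ≡⟨ ∑-cong n (λ y → *-distribˡ-∑ m (⊥? u y) _) ⟩
    ∑[ y ≤ n ] ⊥? u y * (∑[ x ≤ m ] ⊥? (u * y) x * g (u * y * x))
      ≡⟨ ∑-cong n (λ y → cong (⊥? u y *_) (coprimeCount-∷ (u * y) m ns)) ⟩
    ∑[ y ≤ n ] ⊥? u y * coprimeSum (u * y) ns (λ w → Φ w m) ∎
    where
    open ≡-Reasoning
    g : ℕ → ℕ
    g w = coprimeCount w ns
    assoc-comm : ∀ u x y → u * x * y ≡ u * y * x
    assoc-comm = solve-∀
    exchange : ∀ x y → ⊥? u x * (⊥? (u * x) y * g (u * x * y)) ≡ ⊥? u y * (⊥? (u * y) x * g (u * y * x))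
    exchange x y = begin
      ⊥? u x * (⊥? (u * x) y * g (u * x * y)) ≡⟨ *-assoc (⊥? u x) _ _ ⟨
      ⊥? u x * ⊥? (u * x) y * g (u * x * y)
        ≡⟨ cong₂ _*_ (⊥?-exchange u x y) (cong g (assoc-comm u x y)) ⟩
      ⊥? u y * ⊥? (u * y) x * g (u * y * x)   ≡⟨ *-assoc (⊥? u y) _ _ ⟩
      ⊥? u y * (⊥? (u * y) x * g (u * y * x)) ∎

  ∏-≤ : ∀ {r n} {ms : Vec ℕ r} → All (_≤ n) ms → ∏ ms ≤ n ^ r
  ∏-≤ []              = ≤-refl
  ∏-≤ (m≤n ∷ ms≤n) = *-mono-≤ m≤n (∏-≤ ms≤n)

  -- Fixing an entry `y` multiplies the modulus by `y` and hence the error `e` by `τ y`; summing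
  -- over `y` turns this into one factor `∑ n τ` per remaining coordinate. This is why `e` has to be
  -- arbitrary.
  coprimeSum-Φ : ∀ {r n u e a a′} {ns : Vec ℕ r} → Equidistributed u e → a ≤ n → a′ ≤ n → All (_≤ n) ns →
                 a′ * coprimeSum u ns (λ w → Φ w a) ≤
                 a * coprimeSum u ns (λ w → Φ w a′) + 2 * n * e * ∑ n τ ^ r
  coprimeSum-Φ {n = n} {u} {e} {a} {a′} E a≤n a′≤n [] = begin
    a′ * Φ u a                        ≡⟨ cong (λ q → a′ * Φ u q) (sym (n/1≡n a)) ⟩
    a′ * Φ u (a / 1)                  ≤⟨ E 1 a a′ ⟩
    a * Φ u (a′ / 1) + (a + a′) * e   ≡⟨ cong (λ q → a * Φ u q + (a + a′) * e) (n/1≡n a′) ⟩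
    a * Φ u a′ + (a + a′) * e         ≤⟨ +-monoʳ-≤ (a * Φ u a′) (*-monoˡ-≤ e (+-mono-≤ a≤n a′≤n)) ⟩
    a * Φ u a′ + (n + n) * e          ≡⟨ cong (a * Φ u a′ +_) (double n e) ⟩
    a * Φ u a′ + 2 * n * e * 1        ∎
    where
    open ≤-Reasoning
    double : ∀ n e → (n + n) * e ≡ 2 * n * e * 1
    double = solve-∀
  coprimeSum-Φ {suc r} {n} {u} {e} {a} {a′} {m ∷ ns} E a≤n a′≤n (m≤n ∷ ns≤n) = begin
    a′ * (∑[ y ≤ m ] ⊥? u y * S a (u * y))
      ≡⟨ *-distribˡ-∑ m a′ _ ⟨
    ∑[ y ≤ m ] a′ * (⊥? u y * S a (u * y))
      ≤⟨ ∑-mono-≤ m bound ⟩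
    ∑[ y ≤ m ] (a * (⊥? u y * S a′ (u * y)) + 2 * n * e * T ^ r * τ y)
      ≡⟨ trans (∑-distrib-+ m _ _) (cong₂ _+_ (*-distribˡ-∑ m a _) (*-distribˡ-∑ m (2 * n * e * T ^ r) τ)) ⟩
    a * (∑[ y ≤ m ] ⊥? u y * S a′ (u * y)) + 2 * n * e * T ^ r * ∑ m τ
      ≤⟨ +-monoʳ-≤ (a * _) (*-monoʳ-≤ (2 * n * e * T ^ r) (∑-monoˡ-≤ τ m≤n)) ⟩
    a * (∑[ y ≤ m ] ⊥? u y * S a′ (u * y)) + 2 * n * e * T ^ r * T
      ≡⟨ cong (a * (∑[ y ≤ m ] ⊥? u y * S a′ (u * y)) +_) (rotate (2 * n * e) (T ^ r) T) ⟩
    a * (∑[ y ≤ m ] ⊥? u y * S a′ (u * y)) + 2 * n * e * (T * T ^ r) ∎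
    where
    open ≤-Reasoning
    T : ℕ
    T = ∑ n τ
    S : ℕ → ℕ → ℕ
    S a v = coprimeSum v ns (λ w → Φ w a)
    rotate : ∀ k s t → k * s * t ≡ k * (t * s)
    rotate = solve-∀
    swap : ∀ a c s → a * (c * s) ≡ c * (a * s)
    swap = solve-∀
    expand : ∀ a c s n e t T → c * (a * s + 2 * n * (e * t) * T) ≡ a * (c * s) + c * (2 * n * e * T * t)
    expand = solve-∀
    bound : ∀ y → 1 ≤ y → y ≤ m →
            a′ * (⊥? u y * S a (u * y)) ≤ a * (⊥? u y * S a′ (u * y)) + 2 * n * e * T ^ r * τ y
    bound y@(suc _) _ _ = begin
      a′ * (⊥? u y * S a (u * y))
        ≡⟨ swap a′ (⊥? u y) _ ⟩
      ⊥? u y * (a′ * S a (u * y))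
        ≤⟨ *-monoʳ-≤ (⊥? u y) (coprimeSum-Φ (equidistributed-* {u} y E) a≤n a′≤n ns≤n) ⟩
      ⊥? u y * (a * S a′ (u * y) + 2 * n * (e * τ y) * T ^ r)
        ≡⟨ expand a (⊥? u y) _ n e (τ y) (T ^ r) ⟩
      a * (⊥? u y * S a′ (u * y)) + ⊥? u y * (2 * n * e * T ^ r * τ y)
        ≤⟨ +-monoʳ-≤ (a * _) (*-monoˡ-≤ _ (𝟙≤1 (coprime? u _))) ⟩
      a * (⊥? u y * S a′ (u * y)) + 1 * (2 * n * e * T ^ r * τ y)
        ≡⟨ cong (a * (⊥? u y * S a′ (u * y)) +_) (*-identityˡ _) ⟩
      a * (⊥? u y * S a′ (u * y)) + 2 * n * e * T ^ r * τ y ∎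

  -- For each fixed first entry `x` the induction hypothesis, with error `e * τ x`, replaces `ms` by
  -- `ms′`; then `coprimeSum-Φ` changes the first bound from `m` to `m′`. The coordinates contribute
  -- equal errors, whence the factor `r`.
  coprimeCount-discrepancy : ∀ {r n u e} {ms ms′ : Vec ℕ r} → Equidistributed u e →
                             All (_≤ n) ms → All (_≤ n) ms′ →
                             ∏ ms′ * coprimeCount u ms ≤
                             ∏ ms * coprimeCount u ms′ + r * (2 * n ^ r * e * ∑ n τ ^ (r ∸ 1))
  coprimeCount-discrepancy E [] [] = m≤m+n 1 0
  coprimeCount-discrepancy {suc r} {n} {u} {e} {m ∷ ms} {m′ ∷ ms′} E (m≤n ∷ ms≤n) (m′≤n ∷ ms′≤n) = begin
    m′ * ∏ ms′ * (∑[ x ≤ m ] ⊥? u x * g (u * x) ms)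
      ≡⟨ trans (*-assoc m′ _ _) (cong (m′ *_) (sym (*-distribˡ-∑ m (∏ ms′) _))) ⟩
    m′ * (∑[ x ≤ m ] ∏ ms′ * (⊥? u x * g (u * x) ms))
      ≤⟨ *-monoʳ-≤ m′ (∑-mono-≤ m bound) ⟩
    m′ * (∑[ x ≤ m ] (∏ ms * (⊥? u x * g (u * x) ms′) + X * τ x))
      ≡⟨ cong (m′ *_) (trans (∑-distrib-+ m _ _) (cong₂ _+_ (*-distribˡ-∑ m (∏ ms) _) (*-distribˡ-∑ m X τ))) ⟩
    m′ * (∏ ms * coprimeCount u (m ∷ ms′) + X * ∑ m τ)
      ≡⟨ distrib m′ (∏ ms) (coprimeCount u (m ∷ ms′)) (X * ∑ m τ) ⟩
    ∏ ms * (m′ * coprimeCount u (m ∷ ms′)) + m′ * (X * ∑ m τ)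
      ≤⟨ +-mono-≤ (≤-reflexive (cong (λ s → ∏ ms * (m′ * s)) (coprimeCount-∷ u m ms′)))
                  (*-mono-≤ m′≤n (*-monoʳ-≤ X (∑-monoˡ-≤ τ m≤n))) ⟩
    ∏ ms * (m′ * coprimeSum u ms′ (λ w → Φ w m)) + n * (X * T)
      ≤⟨ +-monoˡ-≤ _ (*-monoʳ-≤ (∏ ms) (coprimeSum-Φ E m≤n m′≤n ms′≤n)) ⟩
    ∏ ms * (m * coprimeSum u ms′ (λ w → Φ w m′) + 2 * n * e * T ^ r) + n * (X * T)
      ≡⟨ cong₂ (λ s t → ∏ ms * (m * s + 2 * n * e * T ^ r) + n * t) (sym (coprimeCount-∷ u m′ ms′)) (X*T r) ⟩
    ∏ ms * (m * coprimeCount u (m′ ∷ ms′) + 2 * n * e * T ^ r) + n * (r * (2 * n ^ r * e * T ^ r))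
      ≡⟨ cong (_+ n * (r * (2 * n ^ r * e * T ^ r))) (factor (∏ ms) m _ _) ⟩
    m * ∏ ms * coprimeCount u (m′ ∷ ms′) + ∏ ms * (2 * n * e * T ^ r) + n * (r * (2 * n ^ r * e * T ^ r))
      ≤⟨ +-monoˡ-≤ _ (+-monoʳ-≤ (m * ∏ ms * _) (*-monoˡ-≤ _ (∏-≤ ms≤n))) ⟩
    m * ∏ ms * coprimeCount u (m′ ∷ ms′) + n ^ r * (2 * n * e * T ^ r) + n * (r * (2 * n ^ r * e * T ^ r))
      ≡⟨ collect (m * ∏ ms * coprimeCount u (m′ ∷ ms′)) n (n ^ r) e (T ^ r) r ⟩
    m * ∏ ms * coprimeCount u (m′ ∷ ms′) + suc r * (2 * (n * n ^ r) * e * T ^ r) ∎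
    where
    open ≤-Reasoning
    g : ∀ {r} → ℕ → Vec ℕ r → ℕ
    g = coprimeCount
    T X : ℕ
    T = ∑ n τ
    X = r * (2 * n ^ r * e * T ^ (r ∸ 1))
    -- Truncated subtraction breaks `T ^ (r ∸ 1) * T ≡ T ^ r` at `r = 0`, where the factor `r` makes
    -- both sides vanish.
    X*T : ∀ r → r * (2 * n ^ r * e * T ^ (r ∸ 1)) * T ≡ r * (2 * n ^ r * e * T ^ r)
    X*T zero    = refl
    X*T (suc r) = rotate (suc r) (2 * n ^ suc r * e) (T ^ r) T
      where
      rotate : ∀ r k s t → r * (k * s) * t ≡ r * (k * (t * s))
      rotate = solve-∀
    distrib : ∀ m p s t → m * (p * s + t) ≡ p * (m * s) + m * t
    distrib = solve-∀
    factor : ∀ p m s t → p * (m * s + t) ≡ m * p * s + p * t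
    factor = solve-∀
    collect : ∀ s n N e T r →
              s + N * (2 * n * e * T) + n * (r * (2 * N * e * T)) ≡ s + suc r * (2 * (n * N) * e * T)
    collect = solve-∀
    swap : ∀ a c s → a * (c * s) ≡ c * (a * s)
    swap = solve-∀
    expand : ∀ p c s r N e t T → c * (p * s + r * (2 * N * (e * t) * T)) ≡
      p * (c * s) + c * (r * (2 * N * e * T) * t)
    expand = solve-∀
    bound : ∀ x → 1 ≤ x → x ≤ m →
            ∏ ms′ * (⊥? u x * g (u * x) ms) ≤ ∏ ms * (⊥? u x * g (u * x) ms′) + X * τ x
    bound x@(suc _) _ _ = begin
      ∏ ms′ * (⊥? u x * g (u * x) ms)
        ≡⟨ swap (∏ ms′) (⊥? u x) _ ⟩
      ⊥? u x * (∏ ms′ * g (u * x) ms)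
        ≤⟨ *-monoʳ-≤ (⊥? u x) (coprimeCount-discrepancy (equidistributed-* {u} x E) ms≤n ms′≤n) ⟩
      ⊥? u x * (∏ ms * g (u * x) ms′ + r * (2 * n ^ r * (e * τ x) * T ^ (r ∸ 1)))
        ≡⟨ expand (∏ ms) (⊥? u x) _ r (n ^ r) e (τ x) (T ^ (r ∸ 1)) ⟩
      ∏ ms * (⊥? u x * g (u * x) ms′) + ⊥? u x * (X * τ x)
        ≤⟨ +-monoʳ-≤ (∏ ms * _) (*-monoˡ-≤ _ (𝟙≤1 (coprime? u _))) ⟩
      ∏ ms * (⊥? u x * g (u * x) ms′) + 1 * (X * τ x)
        ≡⟨ cong (∏ ms * (⊥? u x * g (u * x) ms′) +_) (*-identityˡ _) ⟩
      ∏ ms * (⊥? u x * g (u * x) ms′) + X * τ x ∎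

  -- Pairwise coprime tuples have positive density

  𝟙-¬-≤ : ∀ {P Q R : Set} (P? : Dec P) (Q? : Dec Q) (R? : Dec R) → (P → Q → R) →
          𝟙 (¬? R?) ≤ 𝟙 (¬? P?) + 𝟙 (¬? Q?)
  𝟙-¬-≤ _       _       (yes _) _ = z≤n
  𝟙-¬-≤ (no _)  _       (no _)  _ = m≤m+n 1 _
  𝟙-¬-≤ (yes _) (no _)  (no _)  _ = ≤-refl
  𝟙-¬-≤ (yes p) (yes q) (no ¬r) f = contradiction (f p q) ¬r

  multiplesUpTo : ℕ → ℕ → ℕ
  multiplesUpTo n d = ∑[ x ≤ n ] 𝟙 (d ∣? x)

  *-multiplesUpTo : ∀ n d .{{_ : NonZero d}} → d * multiplesUpTo n d ≤ n
  *-multiplesUpTo n d = begin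
    d * (∑[ x ≤ n ] 𝟙 (d ∣? x))      ≡⟨ cong (d *_) (∑-cong n λ x → sym (*-identityʳ (𝟙 (d ∣? x)))) ⟩
    d * (∑[ x ≤ n ] 𝟙 (d ∣? x) * 1)
      ≡⟨ cong (d *_) (trans (∑-multiples d n (const 1)) (trans (∑-const (n / d) 1) (*-identityʳ (n / d)))) ⟩
    d * (n / d)                    ≡⟨ *-comm d (n / d) ⟩
    n / d * d                      ≤⟨ m/n*n≤m n d ⟩
    n                              ∎
    where open ≤-Reasoning

  -- After exchanging the sums, each `d` is left with its at most n/d multiples; `ι-∑τ≤` turns this
  -- into n times a harmonic number.
  ∑τ-≤ : ∀ n → ∑ n τ ≤ ∑ n (multiplesUpTo n)
  ∑τ-≤ n = begin
    ∑[ x ≤ n ] ∑[ d ≤ x ] 𝟙 (d ∣? x)  ≤⟨ ∑-mono-≤ n (λ x _ x≤n → ∑-monoˡ-≤ _ x≤n) ⟩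
    ∑[ x ≤ n ] ∑[ d ≤ n ] 𝟙 (d ∣? x)  ≡⟨ ∑-swap n n _ ⟩
    ∑ n (multiplesUpTo n)             ∎
    where open ≤-Reasoning

  -- Serves to absorb the loss from rounding `α`, of order n^(r-1), into the error term with
  -- `∑ n τ ^ (r ∸ 1)`.
  n≤∑τ : ∀ n → n ≤ ∑ n τ
  n≤∑τ n = begin
    n            ≡⟨ *-identityʳ n ⟨
    n * 1        ≡⟨ ∑-const n 1 ⟨
    ∑[ x ≤ n ] 1 ≤⟨ ∑-mono-≤ n (λ x 1≤x _ → ≤-trans (≤-reflexive (sym (𝟙-yes (1 ∣? x) (1∣ x))))
                                                    (f≤∑f (λ d → 𝟙 (d ∣? x)) ≤-refl 1≤x)) ⟩
    ∑ n τ        ∎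
    where open ≤-Reasoning

  -- The induction remembers the last hit `a` together with `g * count ≤ a + g`; the next hit lies
  -- at least `g` further on, so both sides grow in step.
  ∑-separated : ∀ {P : ℕ → Set} (P? : ∀ a → Dec (P a)) g →
                (∀ {a b} → a < b → P a → P b → a + g ≤ b) →
                ∀ N → g * (∑[ a ≤ N ] 𝟙 (P? a)) ≤ N + g
  ∑-separated {P} P? g sep N with go N
    where
    go : ∀ N → (∑[ a ≤ N ] 𝟙 (P? a) ≡ 0) ⊎ ∃ λ a → a ≤ N × P a × g * (∑[ a ≤ N ] 𝟙 (P? a)) ≤ a + g
    go zero = inj₁ refl
    go (suc N) with go N | P? (suc N)
    ... | inj₁ eq | no _ = inj₁ (trans (+-identityʳ _) eq)
    ... | inj₁ eq | yes p = inj₂ (suc N , ≤-refl , p ,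
          ≤-trans (≤-reflexive (trans (cong (λ s → g * (s + 1)) eq) (*-identityʳ g))) (m≤n+m g (suc N)))
    ... | inj₂ (a , a≤N , pa , bound) | no _ = inj₂ (a , m≤n⇒m≤1+n a≤N , pa ,
          ≤-trans (≤-reflexive (cong (g *_) (+-identityʳ _))) bound)
    ... | inj₂ (a , a≤N , pa , bound) | yes p = inj₂ (suc N , ≤-refl , p , (begin
          g * ((∑[ a ≤ N ] 𝟙 (P? a)) + 1)      ≡⟨ *-distribˡ-+ g _ 1 ⟩
          g * (∑[ a ≤ N ] 𝟙 (P? a)) + g * 1  ≤⟨ +-mono-≤ bound (≤-reflexive (*-identityʳ g)) ⟩
          a + g + g                        ≤⟨ +-monoˡ-≤ g (sep (s≤s a≤N) pa p) ⟩
          suc N + g                        ∎))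
      where open ≤-Reasoning
  ... | inj₁ eq = ≤-trans (≤-reflexive (trans (cong (g *_) eq) (*-zeroʳ g))) z≤n
  ... | inj₂ (a , a≤N , _ , bound) = ≤-trans bound (+-monoˡ-≤ g a≤N)

  -- Telescoping 1/j² ≤ 1/(j-1) - 1/j.
  ∑-inverseSquares : ∀ k .{{_ : NonZero k}} C J (s : ℕ → ℕ) →
                     (∀ j → 1 ≤ j → j ≤ J → s j * ((k + j) * (k + j)) ≤ C) →
                     ∑ J s * k * (k + J) ≤ C * J
  ∑-inverseSquares k C zero    s s≤ = z≤n
  ∑-inverseSquares k C (suc J) s s≤ = *-cancelʳ-≤ _ _ (k + J) {{≢-nonZero (k+J≢0 k)}} (begin
    (∑ J s + s (suc J)) * k * (k + suc J) * (k + J)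
      ≡⟨ expand (∑ J s) (s (suc J)) k J ⟩
    ∑ J s * k * (k + J) * (k + J + 1) + k * (s (suc J) * ((k + J) * (k + suc J)))
      ≤⟨ +-mono-≤ (*-monoˡ-≤ (k + J + 1) (∑-inverseSquares k C J s λ j 1≤j j≤J → s≤ j 1≤j (m≤n⇒m≤1+n j≤J)))
                  (*-monoʳ-≤ k (≤-trans (*-monoʳ-≤ (s (suc J)) (*-monoˡ-≤ (k + suc J) (+-monoʳ-≤ k (n≤1+n J))))
                                        (s≤ (suc J) (s≤s z≤n) ≤-refl))) ⟩
    C * J * (k + J + 1) + k * C
      ≡⟨ collect C J k ⟩
    C * suc J * (k + J) ∎)
    where
    open ≤-Reasoning
    k+J≢0 : ∀ k .{{_ : NonZero k}} → k + J ≢ 0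
    k+J≢0 (suc k) ()
    expand : ∀ S s k J → (S + s) * k * (k + suc J) * (k + J) ≡
             S * k * (k + J) * (k + J + 1) + k * (s * ((k + J) * (k + suc J)))
    expand = solve-∀
    collect : ∀ C J k → C * J * (k + J + 1) + k * C ≡ C * suc J * (k + J)
    collect = solve-∀

  -- Common divisors within the progression 1 modulo `Q`

  module Progression (Q : ℕ) .{{_ : NonZero Q}} where

    X : ℕ → ℕ
    X a = suc (Q * a)

    ∣X⇒coprime : ∀ {g} a → g ∣ X a → Coprime g Q
    ∣X⇒coprime a g∣X (i∣g , i∣Q) = ∣1⇒≡1 (∣m+n∣n⇒∣m {n = Q * a} (∣-trans i∣g g∣X) (∣m⇒∣m*n a i∣Q))

    -- `g` divides the difference `Q * (b ∸ a)` and is coprime to `Q`, so it divides `b ∸ a`.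
    X-separated : ∀ g {a b} → a < b → g ∣ X a → g ∣ X b → a + g ≤ b
    X-separated g {a} {b} a<b g∣Xa g∣Xb = subst (a + g ≤_) (m+[n∸m]≡n (<⇒≤ a<b)) (+-monoʳ-≤ a (∣⇒≤ {{>-nonZero (m<n⇒0<n∸m a<b)}} g∣b∸a))
      where
      shift : ∀ Q a k → suc (Q * (a + k)) ≡ suc (Q * a) + Q * k
      shift = solve-∀
      g∣b∸a : g ∣ b ∸ a
      g∣b∸a = coprime-divisor (∣X⇒coprime a g∣Xa) (∣m+n∣m⇒∣n
        (subst (g ∣_) (trans (cong X (sym (m+[n∸m]≡n (<⇒≤ a<b)))) (shift Q a (b ∸ a))) g∣Xb) g∣Xa)

    -- Shifted down by one, the entries `X a` are the multiples of `Q`, so `∑-progression` applies.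
    ∑-X-≤ : ∀ {N n} (h : ℕ → ℕ) → X N ≤ n → ∑[ a ≤ N ] h (X a) ≤ ∑ n h
    ∑-X-≤ {N} {n} h XN≤n = begin
      ∑[ a ≤ N ] h (X a)
        ≡⟨ cong (λ N → ∑[ a ≤ N ] h (X a)) (trans (/-congˡ {o = Q} (*-comm Q N)) (m*n/n≡m N Q)) ⟨
      ∑[ a ≤ Q * N / Q ] h (X a)       ≤⟨ ∑-progression Q (Q * N) (h ∘ suc) ⟩
      ∑[ x ≤ Q * N ] h (suc x)         ≤⟨ m≤n+m _ (h 1) ⟩
      h 1 + ∑[ x ≤ Q * N ] h (suc x)   ≡⟨ ∑-suc (Q * N) h ⟨
      ∑ (X N) h                        ≤⟨ ∑-monoˡ-≤ h XN≤n ⟩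
      ∑ n h                            ∎
      where open ≤-Reasoning

    clash? : ℕ → ℕ → ℕ
    clash? u x = 𝟙 (¬? (coprime? u x))

    clash?-* : ∀ u v x → clash? (u * v) x ≤ clash? u x + clash? v x
    clash?-* u v x = 𝟙-¬-≤ (coprime? u x) (coprime? v x) (coprime? (u * v) x) coprime-*⁺

    module Clashes (K : ℕ) .{{_ : NonZero K}} (small∣Q : ∀ d .{{_ : NonZero d}} → d ≤ K → d ∣ Q) (J : ℕ) where

      -- Written as a sum so that the possible common divisors, those with K < g ≤ N, are the
      -- numbers `K + j` with 1 ≤ j ≤ J.
      N : ℕ
      N = K + J

      hit? : ℕ → ℕ → ℕ
      hit? g a = 𝟙 (g ∣? X a)

      -- The witness is the gcd `g` of the two entries. Being coprime to `Q`, it would be 1 if it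
      -- were at most `K`, since then it would divide `Q`. It is at most `N` because distinct
      -- indices hit by `g` differ by at least `g`.
      clash?-≤ : ∀ {a b} → a ≤ N → b ≤ N →
                 clash? (X a) (X b) ≤ 𝟙 (a ≟ b) + ∑[ j ≤ J ] hit? (K + j) a * hit? (K + j) b
      clash?-≤ {a} {b} a≤N b≤N with a ≟ b | coprime? (X a) (X b)
      ... | _       | yes X⊥X  = ≤-trans (≤-reflexive (𝟙-no (¬? (coprime? (X a) (X b))) λ ¬X⊥X → ¬X⊥X X⊥X)) z≤n
      ... | yes a≡b | no _     = ≤-trans (𝟙≤1 (¬? (coprime? (X a) (X b))))
          (≤-trans (≤-reflexive (sym (𝟙-yes (a ≟ b) a≡b))) (m≤m+n _ _))
      ... | no a≢b  | no ¬X⊥X  = ≤-trans (𝟙≤1 (¬? (coprime? (X a) (X b)))) (≤-trans (≤-reflexive (sym (trans (cong (λ d → hit? d a * hit? d b) K+j≡g)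
          (cong₂ _*_ (𝟙-yes (g ∣? X a) g∣Xa) (𝟙-yes (g ∣? X b) g∣Xb)))))
          (≤-trans (f≤∑f {J} (λ j → hit? (K + j) a * hit? (K + j) b) (m<n⇒0<n∸m K<g) (m≤n+o⇒m∸n≤o g K g≤N)) (m≤n+m _ (𝟙 (a ≟ b)))))
        where
        g : ℕ
        g = gcd (X a) (X b)
        g∣Xa : g ∣ X a
        g∣Xa = gcd[m,n]∣m (X a) (X b)
        g∣Xb : g ∣ X b
        g∣Xb = gcd[m,n]∣n (X a) (X b)
        instance
          g≢0 : NonZero g
          g≢0 = ≢-nonZero λ g≡0 → case0 (0∣⇒≡0 (subst (_∣ X a) g≡0 g∣Xa))
            where
            case0 : ¬ X a ≡ 0
            case0 ()
        K<g : K < g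
        K<g = ≰⇒> λ g≤K → ¬X⊥X (gcd≡1⇒coprime (∣X⇒coprime a g∣Xa (∣-refl , small∣Q g g≤K)))
        K+j≡g : K + (g ∸ K) ≡ g
        K+j≡g = m+[n∸m]≡n (<⇒≤ K<g)
        g≤N : g ≤ N
        g≤N with <-cmp a b
        ... | tri< a<b _ _ = ≤-trans (m≤n+m g a) (≤-trans (X-separated g a<b g∣Xa g∣Xb) b≤N)
        ... | tri≈ _ a≡b _ = contradiction a≡b a≢b
        ... | tri> _ _ b<a = ≤-trans (m≤n+m g b) (≤-trans (X-separated g b<a g∣Xb g∣Xa) a≤N)

      hits : ℕ → ℕ
      hits g = ∑ N (hit? g)

      hits-≤ : ∀ g → g ≤ N → g * hits g ≤ 2 * N
      hits-≤ g g≤N = ≤-trans (∑-separated (λ a → g ∣? X a) g (X-separated g) N)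
        (+-monoʳ-≤ N (≤-trans g≤N (≤-reflexive (sym (+-identityʳ N)))))

      ∑-diagonal : ∑[ a ≤ N ] ∑[ b ≤ N ] 𝟙 (a ≟ b) ≤ N
      ∑-diagonal = begin
        -- Two distinct `b` cannot both equal `a`, so any gap is allowed. The gap `suc N` gives
        -- (N+1) * count ≤ 2N+1, hence count < 2.
        ∑[ a ≤ N ] ∑[ b ≤ N ] 𝟙 (a ≟ b) ≤⟨ ∑-mono N (λ a → ≤-pred (*-cancelˡ-< (suc N) _ 2 (≤-trans (s≤s
          (∑-separated (a ≟_) (suc N) (λ a<b p q → contradiction (trans (sym p) q) (<⇒≢ a<b)) N))
          (≤-reflexive (double N))))) ⟩
        ∑[ a ≤ N ] 1                    ≡⟨ trans (∑-const N 1) (*-identityʳ N) ⟩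
        N                               ∎
        where
        open ≤-Reasoning
        double : ∀ N → suc (N + suc N) ≡ suc N * 2
        double = solve-∀

      clashes : ℕ
      clashes = ∑[ a ≤ N ] ∑[ b ≤ N ] clash? (X a) (X b)

      -- The 5 is 1 + 4. The diagonal has at most `N` pairs, and K ≤ N. The off-diagonal pairs
      -- sharing `g` number at most the square of `hits g`, which is at most 4N²/g², and the sum of
      -- 1/g² over g > K is at most 1/K.
      clashes-≤ : K * clashes ≤ 5 * (N * N)
      clashes-≤ = begin
        K * clashes
          ≤⟨ *-monoʳ-≤ K (∑-mono-≤ N λ a _ a≤N → ∑-mono-≤ N λ b _ b≤N → clash?-≤ a≤N b≤N) ⟩
        K * (∑[ a ≤ N ] ∑[ b ≤ N ] (𝟙 (a ≟ b) + ∑[ j ≤ J ] hit? (K + j) a * hit? (K + j) b))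
          ≡⟨ cong (K *_) (trans (∑-cong N λ a → ∑-distrib-+ N _ _) (∑-distrib-+ N _ _)) ⟩
        K * (∑[ a ≤ N ] ∑[ b ≤ N ] 𝟙 (a ≟ b) + ∑[ a ≤ N ] ∑[ b ≤ N ] ∑[ j ≤ J ] hit? (K + j) a * hit? (K + j) b)
          ≤⟨ *-monoʳ-≤ K (+-mono-≤ ∑-diagonal (≤-reflexive square)) ⟩
        K * (N + S)
          ≡⟨ *-distribˡ-+ K N S ⟩
        K * N + K * S
          ≤⟨ +-mono-≤ (*-monoˡ-≤ N (m≤m+n K J)) K*S≤ ⟩
        N * N + 4 * (N * N) ∎
        where
        open ≤-Reasoning
        instance
          N≢0 : NonZero N
          N≢0 = >-nonZero (≤-trans (>-nonZero⁻¹ K) (m≤m+n K J))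
        S : ℕ
        S = ∑[ j ≤ J ] hits (K + j) * hits (K + j)
        square : ∑[ a ≤ N ] ∑[ b ≤ N ] ∑[ j ≤ J ] hit? (K + j) a * hit? (K + j) b ≡ S
        square = trans (∑-cong N λ a → ∑-swap N J _) (trans (∑-swap N J _) (∑-cong J λ j →
          trans (∑-cong N λ a → *-distribˡ-∑ N (hit? (K + j) a) (hit? (K + j))) (*-distribʳ-∑ N (hits (K + j)) (hit? (K + j)))))
        regroup : ∀ h g → h * h * (g * g) ≡ g * h * (g * h)
        regroup = solve-∀
        double² : ∀ N → 2 * N * (2 * N) ≡ 4 * (N * N)
        double² = solve-∀
        hits² : ∀ j → 1 ≤ j → j ≤ J → hits (K + j) * hits (K + j) * ((K + j) * (K + j)) ≤ 4 * (N * N)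
        hits² j _ j≤J = begin
          hits (K + j) * hits (K + j) * ((K + j) * (K + j))     ≡⟨ regroup (hits (K + j)) (K + j) ⟩
          (K + j) * hits (K + j) * ((K + j) * hits (K + j))
            ≤⟨ *-mono-≤ (hits-≤ (K + j) (+-monoʳ-≤ K j≤J)) (hits-≤ (K + j) (+-monoʳ-≤ K j≤J)) ⟩
          2 * N * (2 * N)                                       ≡⟨ double² N ⟩
          4 * (N * N)                                           ∎
        K*S≤ : K * S ≤ 4 * (N * N)
        K*S≤ = *-cancelʳ-≤ _ _ N (begin
          K * S * N          ≡⟨ cong (_* N) (*-comm K S) ⟩
          S * K * N          ≤⟨ ∑-inverseSquares K (4 * (N * N)) J _ hits² ⟩
          4 * (N * N) * J    ≤⟨ *-monoʳ-≤ (4 * (N * N)) (m≤n+m J K) ⟩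
          4 * (N * N) * N    ∎)

  ^-distribʳ-* : ∀ m n o → (m * n) ^ o ≡ m ^ o * n ^ o
  ^-distribʳ-* m n zero    = refl
  ^-distribʳ-* m n (suc o) = trans (cong (m * n *_) (^-distribʳ-* m n o)) (interchange m n (m ^ o) (n ^ o))
    where
    interchange : ∀ a b c d → a * b * (c * d) ≡ a * c * (b * d)
    interchange = solve-∀

  -- The tuple (1, ..., 1) is always counted.
  1≤coprimeCount : ∀ r n → 1 ≤ n → ∀ u → 1 ≤ coprimeCount u (replicate r n)
  1≤coprimeCount zero    n 1≤n u = ≤-refl
  1≤coprimeCount (suc r) n 1≤n u = begin
    1                                                 ≤⟨ 1≤coprimeCount r n 1≤n (u * 1) ⟩
    coprimeCount (u * 1) (replicate r n)              ≡⟨ *-identityˡ _ ⟨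
    1 * coprimeCount (u * 1) (replicate r n)
      ≡⟨ cong (_* coprimeCount (u * 1) (replicate r n)) (𝟙-yes (coprime? u 1) (∣1⇒≡1 ∘ proj₂)) ⟨
    ⊥? u 1 * coprimeCount (u * 1) (replicate r n)
      ≤⟨ f≤∑f (λ x → ⊥? u x * coprimeCount (u * x) (replicate r n)) ≤-refl 1≤n ⟩
    coprimeCount u (replicate (suc r) n)              ∎
    where open ≤-Reasoning

  module _ (Q : ℕ) .{{_ : NonZero Q}} where
    open Progression Q

    progressionCount : ℕ → ℕ → ℕ → ℕ
    progressionCount N u zero    = 1
    progressionCount N u (suc r) = ∑[ a ≤ N ] ⊥? u (X a) * progressionCount N (u * X a) r

    progressionCount-≤ : ∀ {N n} → X N ≤ n → ∀ u r → progressionCount N u r ≤ coprimeCount u (replicate r n)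
    progressionCount-≤ XN≤n u zero = ≤-refl
    progressionCount-≤ {N} {n} XN≤n u (suc r) = ≤-trans
      (∑-mono N λ a → *-monoʳ-≤ (⊥? u (X a)) (progressionCount-≤ XN≤n (u * X a) r))
      (∑-X-≤ {N} (λ x → ⊥? u x * coprimeCount (u * x) (replicate r n)) XN≤n)

    -- The union bound: a tuple is pairwise coprime and coprime to u unless an entry
    -- clashes with u (at most t choices for each entry) or two entries clash.
    progressionCount-union : ∀ N k → k * (∑[ a ≤ N ] ∑[ b ≤ N ] clash? (X a) (X b)) ≤ N * N →
                             ∀ r u t → (∑[ a ≤ N ] clash? u (X a)) ≤ t →
                             N * k * N ^ r ≤ N * k * progressionCount N u r + r * k * N ^ r * t + r * r * (N * N ^ r)
    progressionCount-union N k few zero    u t clash≤t = m≤n⇒m≤n+o 0 (m≤n⇒m≤n+o 0 ≤-refl)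
    progressionCount-union N k few (suc r) u t clash≤t = begin
      N * k * (N * N ^ r)
        ≡⟨ regroup N k (N ^ r) ⟩
      N * W
        ≡⟨ ∑-const N W ⟨
      ∑[ a ≤ N ] W
        ≤⟨ ∑-mono N bound ⟩
      ∑[ a ≤ N ] (N * k * (⊥? u (X a) * L a) + (r * k * N ^ r * t + r * r * (N * N ^ r)) + r * N ^ r * (k * β a) + clash? u (X a) * W)
        ≡⟨ trans (∑-distrib-+ N _ _) (cong₂ _+_ (trans (∑-distrib-+ N _ _) (cong₂ _+_ (trans (∑-distrib-+ N _ _)
             (cong₂ _+_ (*-distribˡ-∑ N (N * k) _) (∑-const N _)))
             (trans (*-distribˡ-∑ N (r * N ^ r) _) (cong (r * N ^ r *_) (*-distribˡ-∑ N k β)))))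
             (*-distribʳ-∑ N W _)) ⟩
      N * k * progressionCount N u (suc r) + N * (r * k * N ^ r * t + r * r * (N * N ^ r))
        + r * N ^ r * (k * (∑[ a ≤ N ] β a)) + (∑[ a ≤ N ] clash? u (X a)) * W
        ≤⟨ +-mono-≤ (+-monoʳ-≤ (N * k * progressionCount N u (suc r) + N * (r * k * N ^ r * t + r * r * (N * N ^ r)))
                               (*-monoʳ-≤ (r * N ^ r) few))
                    (*-monoˡ-≤ W clash≤t) ⟩
      N * k * progressionCount N u (suc r) + N * (r * k * N ^ r * t + r * r * (N * N ^ r))
        + r * N ^ r * (N * N) + t * W
        -- Pure slack: the coefficient r² + r reached so far is completed to (r + 1)² to match the
        -- statement.
        ≤⟨ m≤m+n _ ((suc r) * (N * (N * N ^ r))) ⟩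
      N * k * progressionCount N u (suc r) + N * (r * k * N ^ r * t + r * r * (N * N ^ r))
        + r * N ^ r * (N * N) + t * W + (suc r) * (N * (N * N ^ r))
        ≡⟨ collect (N * k * progressionCount N u (suc r)) N k r t (N ^ r) ⟩
      N * k * progressionCount N u (suc r) + suc r * k * (N * N ^ r) * t + suc r * suc r * (N * (N * N ^ r)) ∎
      where
      open ≤-Reasoning
      W : ℕ
      W = N * k * N ^ r
      L β : ℕ → ℕ
      L a = progressionCount N (u * X a) r
      β a = ∑[ b ≤ N ] clash? (X a) (X b)
      regroup : ∀ N k P → N * k * (N * P) ≡ N * (N * k * P)
      regroup = solve-∀
      collect : ∀ s N k r t P →
        s + N * (r * k * P * t + r * r * (N * P)) + r * P * (N * N) + t * (N * k * P) + suc r * (N * (N * P)) ≡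
        s + suc r * k * (N * P) * t + suc r * suc r * (N * (N * P))
      collect = solve-∀
      -- Choosing the entry `X a` adds at most `β a` forbidden values for each later entry, and the
      -- sum of `β a` over all `a` is the number of clashing pairs, which `few` controls.
      clash≤t+β : ∀ a → (∑[ b ≤ N ] clash? (u * X a) (X b)) ≤ t + β a
      clash≤t+β a = ≤-trans (∑-mono N λ b → clash?-* u (X a) (X b))
        (≤-trans (≤-reflexive (∑-distrib-+ N _ _)) (+-monoˡ-≤ (β a) clash≤t))
      expand : ∀ c s N k r t b P → c * (N * k * s + r * k * P * (t + b) + r * r * (N * P)) ≡
        N * k * (c * s) + c * (r * k * P * t + r * r * (N * P) + r * P * (k * b))
      expand = solve-∀
      assoc : ∀ a b c d → a + (b + c) + d ≡ a + b + c + d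
      assoc = solve-∀
      bound : ∀ a → W ≤ N * k * (⊥? u (X a) * L a) + (r * k * N ^ r * t + r * r * (N * N ^ r)) + r * N ^ r * (k * β a) + clash? u (X a) * W
      bound a = begin
        W
          ≡⟨ trans (cong (_* W) (𝟙-¬ (coprime? u (X a)))) (*-identityˡ W) ⟨
        (⊥? u (X a) + clash? u (X a)) * W
          ≡⟨ *-distribʳ-+ W (⊥? u (X a)) _ ⟩
        ⊥? u (X a) * W + clash? u (X a) * W
          ≤⟨ +-monoˡ-≤ _ (*-monoʳ-≤ (⊥? u (X a)) (progressionCount-union N k few r (u * X a) (t + β a) (clash≤t+β a))) ⟩
        ⊥? u (X a) * (N * k * L a + r * k * N ^ r * (t + β a) + r * r * (N * N ^ r)) + clash? u (X a) * W
          ≡⟨ cong (_+ clash? u (X a) * W) (expand (⊥? u (X a)) (L a) N k r t (β a) (N ^ r)) ⟩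
        N * k * (⊥? u (X a) * L a) + ⊥? u (X a) * (r * k * N ^ r * t + r * r * (N * N ^ r) + r * N ^ r * (k * β a)) + clash? u (X a) * W
          ≤⟨ +-monoˡ-≤ _ (+-monoʳ-≤ (N * k * (⊥? u (X a) * L a)) (≤-trans (*-monoˡ-≤ _ (𝟙≤1 (coprime? u (X a)))) (≤-reflexive (*-identityˡ _)))) ⟩
        N * k * (⊥? u (X a) * L a) + (r * k * N ^ r * t + r * r * (N * N ^ r) + r * N ^ r * (k * β a)) + clash? u (X a) * W
          ≡⟨ assoc (N * k * (⊥? u (X a) * L a)) _ _ _ ⟩
        N * k * (⊥? u (X a) * L a) + (r * k * N ^ r * t + r * r * (N * N ^ r)) + r * N ^ r * (k * β a) + clash? u (X a) * W ∎

  module Density (r : ℕ) .{{_ : NonZero r}} where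

    -- With this K, clashes-≤ gives 2 r² * clashes ≤ N², so the union bound loses at most
    -- half of the Nʳ tuples.
    K Q B : ℕ
    K = 10 * (r * r)
    Q = K !
    B = (2 * K * Q) ^ r * 2

    instance
      r²≢0 : NonZero (r * r)
      r²≢0 = m*n≢0 r r
      K≢0 : NonZero K
      K≢0 = m*n≢0 10 (r * r)
      Q≢0 : NonZero Q
      Q≢0 = K !≢0

    ∣Q : ∀ d .{{_ : NonZero d}} → d ≤ K → d ∣ Q
    ∣Q (suc d) d≤K = ∣-trans (m∣m*n (d !)) (m≤n⇒m!∣n! d≤K)

    open Progression Q

    progressionCount-large : ∀ J → (K + J) ^ r ≤ 2 * progressionCount Q (K + J) 1 r
    progressionCount-large J = *-cancelˡ-≤ (r * r * N) {{m*n≢0 (r * r) N {{r²≢0}} {{N≢0}}}} (+-cancelʳ-≤ (r * r * (N * N ^ r)) _ _ (begin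
      r * r * N * N ^ r + r * r * (N * N ^ r)
        ≡⟨ double r N (N ^ r) ⟩
      N * (2 * (r * r)) * N ^ r
        -- Nothing clashes with `u = 1`, hence `t = 0`; with `k = 2 * (r * r)` the remaining loss is
        -- exactly half of the left side.
        ≤⟨ progressionCount-union Q N (2 * (r * r)) few r 1 0 (≤-reflexive noClash) ⟩
      N * (2 * (r * r)) * L + r * (2 * (r * r)) * N ^ r * 0 + r * r * (N * N ^ r)
        ≡⟨ collect r N L (N ^ r) ⟩
      r * r * N * (2 * L) + r * r * (N * N ^ r) ∎))
      where
      open ≤-Reasoning
      N L : ℕ
      N = K + J
      L = progressionCount Q N 1 r
      N≢0 : NonZero N
      N≢0 = >-nonZero (≤-trans (>-nonZero⁻¹ K) (m≤m+n K J))
      double : ∀ r N P → r * r * N * P + r * r * (N * P) ≡ N * (2 * (r * r)) * P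
      double = solve-∀
      collect : ∀ r N L P → N * (2 * (r * r)) * L + r * (2 * (r * r)) * P * 0 + r * r * (N * P) ≡
        r * r * N * (2 * L) + r * r * (N * P)
      collect = solve-∀
      noClash : ∑[ a ≤ N ] clash? 1 (X a) ≡ 0
      noClash = trans (∑-cong N λ a → 𝟙-no (¬? (coprime? 1 (X a))) (λ ¬1⊥ → ¬1⊥ (∣1⇒≡1 ∘ proj₁))) (trans (∑-const N 0) (*-zeroʳ N))
      regroup : ∀ r c → 5 * (2 * (r * r) * c) ≡ 10 * (r * r) * c
      regroup = solve-∀
      -- `K` is 5 times `2 * (r * r)`, where 5 is the constant of `clashes-≤`.
      few : 2 * (r * r) * Clashes.clashes K ∣Q J ≤ N * N
      few = *-cancelˡ-≤ 5 (≤-trans (≤-reflexive (regroup r _)) (Clashes.clashes-≤ K ∣Q J))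

    -- The indices up to `(n - 1) / Q` are those whose entries `X a` stay within `n`. If there are
    -- at least `K` of them, the progression supplies enough tuples; otherwise n ≤ 2KQ is bounded
    -- and the tuple of ones suffices. `B` is chosen to serve both cases.
    coprimeCount-large : ∀ n → 1 ≤ n → n ^ r ≤ B * coprimeCount 1 (replicate r n)
    coprimeCount-large n@(suc n-1) 1≤n = go (<-≤-connex (n-1 / Q) K)
      where
      open ≤-Reasoning
      N : ℕ
      N = n-1 / Q
      n≤ : n ≤ suc N * Q
      n≤ = begin
        suc n-1                  ≡⟨ cong suc (m≡m%n+[m/n]*n n-1 Q) ⟩
        suc (n-1 % Q) + N * Q    ≤⟨ +-monoˡ-≤ (N * Q) (m%n<n n-1 Q) ⟩
        suc N * Q                ∎
      go : N < K ⊎ K ≤ N → n ^ r ≤ B * coprimeCount 1 (replicate r n)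
      go (inj₁ N<K) = begin
        n ^ r                ≤⟨ ^-monoˡ-≤ r (≤-trans n≤ (*-monoˡ-≤ Q (≤-trans N<K (m≤n*m K 2)))) ⟩
        (2 * K * Q) ^ r      ≤⟨ m≤m*n ((2 * K * Q) ^ r) 2 ⟩
        B                    ≡⟨ *-identityʳ B ⟨
        B * 1                ≤⟨ *-monoʳ-≤ B (1≤coprimeCount r n 1≤n 1) ⟩
        B * coprimeCount 1 (replicate r n) ∎
      go (inj₂ K≤N) = begin
        n ^ r                            ≤⟨ ^-monoˡ-≤ r n≤KQN ⟩
        (2 * K * Q * N) ^ r              ≡⟨ ^-distribʳ-* (2 * K * Q) N r ⟩
        (2 * K * Q) ^ r * N ^ r          ≡⟨ cong (λ N → (2 * K * Q) ^ r * N ^ r) (m+[n∸m]≡n K≤N) ⟨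
        (2 * K * Q) ^ r * (K + (N ∸ K)) ^ r
          ≤⟨ *-monoʳ-≤ ((2 * K * Q) ^ r) (progressionCount-large (N ∸ K)) ⟩
        (2 * K * Q) ^ r * (2 * progressionCount Q (K + (N ∸ K)) 1 r)
          ≡⟨ trans (cong (λ N → (2 * K * Q) ^ r * (2 * progressionCount Q N 1 r)) (m+[n∸m]≡n K≤N)) (sym (*-assoc ((2 * K * Q) ^ r) 2 _)) ⟩
        B * progressionCount Q N 1 r
          ≤⟨ *-monoʳ-≤ B (progressionCount-≤ Q (s≤s (≤-trans (≤-reflexive (*-comm Q N)) (m/n*n≤m n-1 Q))) 1 r) ⟩
        B * coprimeCount 1 (replicate r n) ∎
        where
        instance
          N≢0 : NonZero N
          N≢0 = >-nonZero (≤-trans (>-nonZero⁻¹ K) K≤N)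
        expand : ∀ K Q N → K * ((N + N) * Q) ≡ 2 * K * Q * N
        expand = solve-∀
        n≤KQN : n ≤ 2 * K * Q * N
        n≤KQN = begin
          n                    ≤⟨ n≤ ⟩
          suc N * Q            ≤⟨ *-monoˡ-≤ Q (+-monoˡ-≤ N (>-nonZero⁻¹ N)) ⟩
          (N + N) * Q          ≤⟨ m≤n*m ((N + N) * Q) K ⟩
          K * ((N + N) * Q)    ≡⟨ expand K Q N ⟩
          2 * K * Q * N        ∎

  -- Lists of tuples

  -- Follows the recursion of `coprimeSum`: the product of `u` with the earlier entries is carried
  -- along, so a tuple can be tested one coordinate at a time.
  Admissible : ∀ {r} → ℕ → Vec ℕ r → Vec ℕ r → Set
  Admissible u []       []       = ⊤
  Admissible u (m ∷ ms) (x ∷ xs) = 1 ≤ x × x ≤ m × Coprime u x × Admissible (u * x) ms xs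

  length-filter-map : ∀ {A B : Set} {P : Pred B 0ℓ} (P? : Decidable P) (f : A → B) ys →
                      length (filter P? (map f ys)) ≡ length (filter (P? ∘ f) ys)
  length-filter-map P? f []       = refl
  length-filter-map P? f (y ∷ ys) with P? (f y)
  ... | yes _ = cong suc (length-filter-map P? f ys)
  ... | no  _ = length-filter-map P? f ys

  length-filter-++ : ∀ {A : Set} {P : Pred A 0ℓ} (P? : Decidable P) xs ys →
                     length (filter P? (xs ++ ys)) ≡ length (filter P? xs) + length (filter P? ys)
  length-filter-++ P? xs ys = trans (cong length (filter-++ P? xs ys)) (length-++ (filter P? xs))

  -- `∑` adds its largest term last, so the list of first entries has to be decomposed from the
  -- right.
  cartesianProductWith-∷ʳ : ∀ {A B C : Set} (f : A → B → C) xs x ys →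
    cartesianProductWith f (xs ∷ʳ x) ys ≡ cartesianProductWith f xs ys ++ map (f x) ys
  cartesianProductWith-∷ʳ f []       x ys = ++-identityʳ _
  cartesianProductWith-∷ʳ f (w ∷ xs) x ys =
    trans (cong (map (f w) ys ++_) (cartesianProductWith-∷ʳ f xs x ys)) (sym (++-assoc (map (f w) ys) _ _))

  length-filter-box : ∀ {r} n {ys : List (Vec ℕ r)} {P : Pred (Vec ℕ (suc r)) 0ℓ} (P? : Decidable P) →
    length (filter P? (cartesianProductWith _∷_ (map suc (upTo n)) ys)) ≡
    ∑[ x ≤ n ] length (filter (P? ∘ (x ∷_)) ys)
  length-filter-box zero    P? = refl
  length-filter-box (suc n) {ys} P? = begin
    length (filter P? (cartesianProductWith _∷_ (map suc (upTo (suc n))) ys))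
      ≡⟨ cong (λ zs → length (filter P? (cartesianProductWith _∷_ zs ys)))
           (trans (cong (map suc) (sym (upTo-∷ʳ n))) (map-++ suc (upTo n) (n ∷ []))) ⟩
    length (filter P? (cartesianProductWith _∷_ (map suc (upTo n) ∷ʳ suc n) ys))
      ≡⟨ cong (length ∘ filter P?) (cartesianProductWith-∷ʳ _∷_ (map suc (upTo n)) (suc n) ys) ⟩
    length (filter P? (cartesianProductWith _∷_ (map suc (upTo n)) ys ++ map (suc n ∷_) ys))
      ≡⟨ length-filter-++ P? (cartesianProductWith _∷_ (map suc (upTo n)) ys) _ ⟩
    length (filter P? (cartesianProductWith _∷_ (map suc (upTo n)) ys)) + length (filter P? (map (suc n ∷_) ys))
      ≡⟨ cong₂ _+_ (length-filter-box n P?) (length-filter-map P? (suc n ∷_) ys) ⟩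
    ∑[ x ≤ suc n ] length (filter (P? ∘ (x ∷_)) ys) ∎
    where open ≡-Reasoning

  ∑-truncate : ∀ {m n} (h : ℕ → ℕ) → m ≤ n → ∑[ x ≤ n ] 𝟙 (x ≤? m) * h x ≡ ∑ m h
  ∑-truncate {m} h m≤n = go (≤⇒≤′ m≤n)
    where
    go : ∀ {n} → m ≤′ n → ∑[ x ≤ n ] 𝟙 (x ≤? m) * h x ≡ ∑ m h
    go ≤′-refl = ≤-antisym
      (∑-mono m λ x → ≤-trans (*-monoˡ-≤ (h x) (𝟙≤1 (x ≤? m))) (≤-reflexive (*-identityˡ (h x))))
      (∑-mono-≤ m λ x _ x≤m → ≤-reflexive (sym (trans (cong (_* h x) (𝟙-yes (x ≤? m) x≤m)) (*-identityˡ (h x)))))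
    go (≤′-step {n} m≤n) = trans (cong₂ _+_ (go m≤n) (cong (_* h (suc n)) (𝟙-no (suc n ≤? m) (<⇒≱ (s≤s (≤′⇒≤ m≤n))))))
      (+-identityʳ _)

  ∑-cong′ : ∀ n {f g : ℕ → ℕ} → (∀ x → 1 ≤ x → f x ≡ g x) → ∑ n f ≡ ∑ n g
  ∑-cong′ zero    f≡g = refl
  ∑-cong′ (suc n) f≡g = cong₂ _+_ (∑-cong′ n f≡g) (f≡g (suc n) (s≤s z≤n))

  -- Allowing any decidable predicate equivalent to `Admissible` lets the induction hypothesis apply
  -- to the slices `P? ∘ (x ∷_)`.
  length-filter≡coprimeCount : ∀ {r} n u (ms : Vec ℕ r) → All (_≤ n) ms →
    {P : Pred (Vec ℕ r) 0ℓ} (P? : Decidable P) →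
    (∀ x → P x → Admissible u ms x) → (∀ x → Admissible u ms x → P x) →
    length (filter P? (box r n)) ≡ coprimeCount u ms
  length-filter≡coprimeCount n u [] [] P? P⇒ ⇒P with P? []
  ... | yes _  = refl
  ... | no ¬p = contradiction (⇒P [] tt) ¬p
  length-filter≡coprimeCount {suc r} n u (m ∷ ms) (m≤n ∷ ms≤n) {P} P? P⇒ ⇒P = begin
    length (filter P? (box (suc r) n))
      ≡⟨ length-filter-box n P? ⟩
    ∑[ x ≤ n ] length (filter (P? ∘ (x ∷_)) (box r n))
      ≡⟨ ∑-cong′ n slice ⟩
    ∑[ x ≤ n ] 𝟙 (x ≤? m) * (⊥? u x * coprimeCount (u * x) ms)
      ≡⟨ ∑-truncate _ m≤n ⟩
    coprimeCount u (m ∷ ms) ∎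
    where
    open ≡-Reasoning
    slice : ∀ x → 1 ≤ x → length (filter (P? ∘ (x ∷_)) (box r n)) ≡ 𝟙 (x ≤? m) * (⊥? u x * coprimeCount (u * x) ms)
    slice x 1≤x with x ≤? m | coprime? u x
    ... | yes x≤m | yes u⊥x = trans
      (length-filter≡coprimeCount n (u * x) ms ms≤n (P? ∘ (x ∷_))
        (λ xs p → proj₂ (proj₂ (proj₂ (P⇒ (x ∷ xs) p))))
        (λ xs adm → ⇒P (x ∷ xs) (1≤x , x≤m , u⊥x , adm)))
      (sym (trans (cong₂ (λ a b → a * (b * coprimeCount (u * x) ms)) (𝟙-yes (x ≤? m) x≤m) (𝟙-yes (coprime? u x) u⊥x))
                  (trans (*-identityˡ _) (*-identityˡ _))))
    ... | yes _ | no ¬u⊥x = trans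
      (cong length (filter-none (P? ∘ (x ∷_)) (List.universal (λ xs p → ¬u⊥x (proj₁ (proj₂ (proj₂ (P⇒ (x ∷ xs) p))))) (box r n))))
      (sym (trans (cong (λ b → 𝟙 (x ≤? m) * (b * coprimeCount (u * x) ms)) (𝟙-no (coprime? u x) ¬u⊥x)) (*-zeroʳ (𝟙 (x ≤? m)))))
    ... | no x≰m | _ = trans
      (cong length (filter-none (P? ∘ (x ∷_)) (List.universal (λ xs p → x≰m (proj₁ (proj₂ (P⇒ (x ∷ xs) p)))) (box r n))))
      (sym (cong (_* (⊥? u x * coprimeCount (u * x) ms)) (𝟙-no (x ≤? m) x≰m)))

  admissible⇒bounds : ∀ {r u} {ms x : Vec ℕ r} → Admissible u ms x → ∀ i → 1 ≤ lookup x i × lookup x i ≤ lookup ms i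
  admissible⇒bounds {ms = _ ∷ _} {_ ∷ _} (1≤x , x≤m , _ , _) zero    = 1≤x , x≤m
  admissible⇒bounds {ms = _ ∷ _} {_ ∷ _} (_ , _ , _ , adm)   (suc i) = admissible⇒bounds adm i

  admissible⇒coprime : ∀ {r u} {ms x : Vec ℕ r} → Admissible u ms x → ∀ i → Coprime u (lookup x i)
  admissible⇒coprime {ms = _ ∷ _} {_ ∷ _} (_ , _ , u⊥x , _) zero    = u⊥x
  admissible⇒coprime {ms = _ ∷ _} {x ∷ _} (_ , _ , _ , adm) (suc i) = coprime-∣ˡ (m∣m*n x) (admissible⇒coprime adm i)

  admissible⇒pairwise : ∀ {r u} {ms x : Vec ℕ r} → Admissible u ms x →
                        ∀ i j → i ≢ j → Coprime (lookup x i) (lookup x j)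
  admissible⇒pairwise {ms = _ ∷ _} {_ ∷ _} _ zero zero i≢j = contradiction refl i≢j
  admissible⇒pairwise {u = u} {_ ∷ _} {_ ∷ _} (_ , _ , _ , adm) zero (suc j) _ =
    coprime-∣ˡ (n∣m*n u) (admissible⇒coprime adm j)
  admissible⇒pairwise {u = u} {_ ∷ _} {_ ∷ _} (_ , _ , _ , adm) (suc i) zero _ =
    Coprime.sym (coprime-∣ˡ (n∣m*n u) (admissible⇒coprime adm i))
  admissible⇒pairwise {ms = _ ∷ _} {_ ∷ _} (_ , _ , _ , adm) (suc i) (suc j) i≢j =
    admissible⇒pairwise adm i j (i≢j ∘ cong suc)

  pairwise⇒admissible : ∀ {r u} {ms x : Vec ℕ r} → (∀ i → 1 ≤ lookup x i × lookup x i ≤ lookup ms i) →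
                        (∀ i → Coprime u (lookup x i)) → (∀ i j → i ≢ j → Coprime (lookup x i) (lookup x j)) →
                        Admissible u ms x
  pairwise⇒admissible {ms = []}    {[]}    bounds u⊥x x⊥x = tt
  pairwise⇒admissible {ms = _ ∷ _} {_ ∷ _} bounds u⊥x x⊥x =
    proj₁ (bounds zero) , proj₂ (bounds zero) , u⊥x zero ,
    pairwise⇒admissible (bounds ∘ suc) (λ i → coprime-*⁺ (u⊥x (suc i)) (x⊥x zero (suc i) λ ()))
      (λ i j i≢j → x⊥x (suc i) (suc j) (i≢j ∘ suc-injective))

open Counting

-- Ordered field arithmetic and the embedding of the natural numbers

module OrderedField (𝓡 : CompleteOrderedField) where
  open Real 𝓡
  open IsDecTotalOrder isDecTotalOrder public
    using (antisym; total; ≤-respˡ-≈; ≤-respʳ-≈; isPartialOrder)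
    renaming (refl to ≤-refl; trans to ≤-trans; reflexive to ≤-reflexive)
  open Algebra.Properties.Monoid.Mult +-monoid using (×-homo-+)
  open Algebra.Properties.Semiring.Mult semiring using (×1-homo-*)
  open Algebra.Properties.Ring ring using (-‿distribˡ-*; -‿involutive)
  open SemiringSolver commutativeSemiring public using (solve; _:=_; _:+_; _:*_; con)

  poset : Poset 0ℓ 0ℓ 0ℓ
  poset = record { isPartialOrder = isPartialOrder }

  module ≤-Reasoning = PartialOrderReasoning poset

  +-monoʳ-≤ : ∀ z {x y} → x ≤ y → z + x ≤ z + y
  +-monoʳ-≤ z x≤y = ≤-respˡ-≈ (+-comm _ z) (≤-respʳ-≈ (+-comm _ z) (+-monoˡ-≤ z x≤y))

  +-mono-≤ : ∀ {w x y z} → w ≤ x → y ≤ z → w + y ≤ x + z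
  +-mono-≤ {x = x} {y} w≤x y≤z = ≤-trans (+-monoˡ-≤ y w≤x) (+-monoʳ-≤ x y≤z)

  x-y+y≈x : ∀ x y → x - y + y ≈ x
  x-y+y≈x x y = trans (+-assoc x (- y) y) (trans (+-congˡ (-‿inverseˡ y)) (+-identityʳ x))

  x+y-y≈x : ∀ x y → x + y - y ≈ x
  x+y-y≈x x y = trans (+-assoc x y (- y)) (trans (+-congˡ (-‿inverseʳ y)) (+-identityʳ x))

  +-cancelʳ-≤ : ∀ z {x y} → x + z ≤ y + z → x ≤ y
  +-cancelʳ-≤ z {x} {y} x+z≤y+z = ≤-respˡ-≈ (x+y-y≈x x z) (≤-respʳ-≈ (x+y-y≈x y z) (+-monoˡ-≤ (- z) x+z≤y+z))

  x≤y+z⇒x-z≤y : ∀ {x y z} → x ≤ y + z → x - z ≤ y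
  x≤y+z⇒x-z≤y {x} {y} {z} x≤y+z = ≤-respʳ-≈ (x+y-y≈x y z) (+-monoˡ-≤ (- z) x≤y+z)

  x≤y⇒0≤y-x : ∀ {x y} → x ≤ y → 0# ≤ y - x
  x≤y⇒0≤y-x {x} x≤y = ≤-respˡ-≈ (-‿inverseʳ x) (+-monoˡ-≤ (- x) x≤y)

  *-monoˡ-≤ : ∀ {z x y} → 0# ≤ z → x ≤ y → z * x ≤ z * y
  *-monoˡ-≤ {z} {x} {y} 0≤z x≤y = begin
    z * x                   ≈⟨ +-identityˡ (z * x) ⟨
    0# + z * x              ≤⟨ +-monoˡ-≤ (z * x) (*-nonneg 0≤z (x≤y⇒0≤y-x x≤y)) ⟩
    z * (y - x) + z * x     ≈⟨ distribˡ z (y - x) x ⟨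
    z * (y - x + x)         ≈⟨ *-congˡ (x-y+y≈x y x) ⟩
    z * y                   ∎
    where open ≤-Reasoning

  *-monoʳ-≤ : ∀ {z x y} → 0# ≤ z → x ≤ y → x * z ≤ y * z
  *-monoʳ-≤ {z} 0≤z x≤y = ≤-respˡ-≈ (*-comm z _) (≤-respʳ-≈ (*-comm z _) (*-monoˡ-≤ 0≤z x≤y))

  *-mono-≤ : ∀ {w x y z} → 0# ≤ y → 0# ≤ x → w ≤ x → y ≤ z → w * y ≤ x * z
  *-mono-≤ 0≤y 0≤x w≤x y≤z = ≤-trans (*-monoʳ-≤ 0≤y w≤x) (*-monoˡ-≤ 0≤x y≤z)

  x≤0⇒0≤-x : ∀ {x} → x ≤ 0# → 0# ≤ - x
  x≤0⇒0≤-x {x} x≤0 = ≤-respʳ-≈ (+-identityˡ (- x)) (x≤y⇒0≤y-x x≤0)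

  0≤1 : 0# ≤ 1#
  0≤1 with total 0# 1#
  ... | inj₁ 0≤1 = 0≤1
  ... | inj₂ 1≤0 = ≤-respʳ-≈ -1*-1≈1 (*-nonneg (x≤0⇒0≤-x 1≤0) (x≤0⇒0≤-x 1≤0))
    where
    -1*-1≈1 : - 1# * - 1# ≈ 1#
    -1*-1≈1 = trans (sym (-‿distribˡ-* 1# (- 1#))) (trans (-‿cong (*-identityˡ (- 1#))) (-‿involutive 1#))

  0≤x+y : ∀ {x y} → 0# ≤ x → 0# ≤ y → 0# ≤ x + y
  0≤x+y 0≤x 0≤y = ≤-respˡ-≈ (+-identityˡ 0#) (+-mono-≤ 0≤x 0≤y)

  x≤x+y : ∀ {x y} → 0# ≤ y → x ≤ x + y
  x≤x+y {x} 0≤y = ≤-respˡ-≈ (+-identityʳ x) (+-monoʳ-≤ x 0≤y)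

  0<1 : 0# < 1#
  0<1 = 0≤1 , 0≉1

  <-≤-trans : ∀ {x y} → 0# < x → x ≤ y → 0# < y
  <-≤-trans (0≤x , 0≉x) x≤y = ≤-trans 0≤x x≤y , λ 0≈y → 0≉x (antisym 0≤x (≤-respʳ-≈ (sym 0≈y) x≤y))

  1≰0 : ¬ 1# ≤ 0#
  1≰0 1≤0 = 0≉1 (antisym 0≤1 1≤0)

  x*x⁻¹≈1 : ∀ {x} → 0# < x → x * x ⁻¹ ≈ 1#
  x*x⁻¹≈1 {x} (_ , 0≉x) = *-inverseʳ x (0≉x ∘ sym)

  x⁻¹-nonneg : ∀ {x} → 0# < x → 0# ≤ x ⁻¹
  x⁻¹-nonneg {x} 0<x with total 0# (x ⁻¹)
  ... | inj₁ 0≤x⁻¹ = 0≤x⁻¹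
  ... | inj₂ x⁻¹≤0 = contradiction
    (≤-respˡ-≈ (x*x⁻¹≈1 0<x) (≤-respʳ-≈ (zeroʳ x) (*-monoˡ-≤ (proj₁ 0<x) x⁻¹≤0))) 1≰0

  x*y*y⁻¹≈x : ∀ x {y} → 0# < y → x * y * y ⁻¹ ≈ x
  x*y*y⁻¹≈x x {y} 0<y = trans (*-assoc x y (y ⁻¹)) (trans (*-congˡ (x*x⁻¹≈1 0<y)) (*-identityʳ x))

  x/y*y≈x : ∀ x {y} → 0# < y → x / y * y ≈ x
  x/y*y≈x x {y} 0<y = trans (*-assoc x (y ⁻¹) y) (trans (*-congˡ (trans (*-comm (y ⁻¹) y) (x*x⁻¹≈1 0<y))) (*-identityʳ x))

  *-cancelʳ-≤ : ∀ {x y z} → 0# < z → x * z ≤ y * z → x ≤ y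
  *-cancelʳ-≤ {x} {y} {z} 0<z xz≤yz =
    ≤-respˡ-≈ (x*y*y⁻¹≈x x 0<z) (≤-respʳ-≈ (x*y*y⁻¹≈x y 0<z) (*-monoʳ-≤ (x⁻¹-nonneg 0<z) xz≤yz))

  *-cancelˡ-≤ : ∀ {x y z} → 0# < z → z * x ≤ z * y → x ≤ y
  *-cancelˡ-≤ {z = z} 0<z zx≤zy = *-cancelʳ-≤ 0<z (≤-respˡ-≈ (*-comm z _) (≤-respʳ-≈ (*-comm z _) zx≤zy))

  *-pos : ∀ {x y} → 0# < x → 0# < y → 0# < x * y
  *-pos {x} {y} 0<x 0<y = *-nonneg (proj₁ 0<x) (proj₁ 0<y) , λ 0≈xy → proj₂ 0<x
    (trans (sym (zeroˡ (y ⁻¹))) (trans (*-congʳ 0≈xy) (x*y*y⁻¹≈x x 0<y)))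

  x≤y*z⇒x/z≤y : ∀ {x y z} → 0# < z → x ≤ y * z → x / z ≤ y
  x≤y*z⇒x/z≤y {y = y} 0<z x≤yz = ≤-respʳ-≈ (x*y*y⁻¹≈x y 0<z) (*-monoʳ-≤ (x⁻¹-nonneg 0<z) x≤yz)

  x*z≤y⇒x≤y/z : ∀ {x y z} → 0# < z → x * z ≤ y → x ≤ y / z
  x*z≤y⇒x≤y/z {x} 0<z xz≤y = ≤-respˡ-≈ (x*y*y⁻¹≈x x 0<z) (*-monoʳ-≤ (x⁻¹-nonneg 0<z) xz≤y)

  1≤x⇒x⁻¹≤1 : ∀ {x} → 1# ≤ x → x ⁻¹ ≤ 1#
  1≤x⇒x⁻¹≤1 {x} 1≤x = ≤-respˡ-≈ (*-identityˡ (x ⁻¹))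
    (x≤y*z⇒x/z≤y (<-≤-trans 0<1 1≤x) (≤-respʳ-≈ (sym (*-identityˡ x)) 1≤x))

  ^-nonneg : ∀ {x} k → 0# ≤ x → 0# ≤ x ^ k
  ^-nonneg zero    0≤x = 0≤1
  ^-nonneg (suc k) 0≤x = *-nonneg 0≤x (^-nonneg k 0≤x)

  ^-mono-≤ : ∀ {x y} k → 0# ≤ x → x ≤ y → x ^ k ≤ y ^ k
  ^-mono-≤ zero    0≤x x≤y = ≤-refl
  ^-mono-≤ (suc k) 0≤x x≤y = *-mono-≤ (^-nonneg k 0≤x) (≤-trans 0≤x x≤y) x≤y (^-mono-≤ k 0≤x x≤y)

  ∣x∣≤y : ∀ {x y} → x ≤ y → - x ≤ y → ∣ x ∣ ≤ y
  ∣x∣≤y {x} x≤y -x≤y with 0# ≤? x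
  ... | yes _ = x≤y
  ... | no  _ = -x≤y

  -x≤∣x∣ : ∀ x → - x ≤ ∣ x ∣
  -x≤∣x∣ x with 0# ≤? x
  ... | no  _   = ≤-refl
  ... | yes 0≤x = ≤-trans (≤-respʳ-≈ (-‿inverseˡ x) (x≤x+y 0≤x)) 0≤x

  ι-1 : ι 1 ≈ 1#
  ι-1 = +-identityʳ 1#

  ι-+ : ∀ m n → ι (m ℕ.+ n) ≈ ι m + ι n
  ι-+ = ×-homo-+ 1#

  ι-* : ∀ m n → ι (m ℕ.* n) ≈ ι m * ι n
  ι-* = ×1-homo-*

  ι-^ : ∀ m k → ι (m ℕ.^ k) ≈ ι m ^ k
  ι-^ m zero    = ι-1
  ι-^ m (suc k) = trans (ι-* m (m ℕ.^ k)) (*-congˡ (ι-^ m k))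

  0≤ι : ∀ n → 0# ≤ ι n
  0≤ι zero    = ≤-refl
  0≤ι (suc n) = 0≤x+y 0≤1 (0≤ι n)

  ι-mono : ∀ {m n} → m ℕ.≤ n → ι m ≤ ι n
  ι-mono {n = n} ℕ.z≤n = 0≤ι n
  ι-mono (ℕ.s≤s m≤n) = +-monoʳ-≤ 1# (ι-mono m≤n)

  1≤ι : ∀ {n} → 1 ℕ.≤ n → 1# ≤ ι n
  1≤ι 1≤n = ≤-respˡ-≈ ι-1 (ι-mono 1≤n)

  0<ι : ∀ n .{{_ : ℕ.NonZero n}} → 0# < ι n
  0<ι (suc n) = <-≤-trans 0<1 (1≤ι {suc n} (ℕ.s≤s ℕ.z≤n))

-- Harmonic sums and the logarithm

module Logarithm (𝓡 : CompleteOrderedField) where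
  open Real 𝓡
  open OrderedField 𝓡
  open Algebra.Properties.CommutativeMonoid.Sum +-commutativeMonoid using (sum; sum-cong-≋)
  open Partition hiding (start)

  H : ℕ → ℝ
  H zero    = 0#
  H (suc n) = H n + ι (suc n) ⁻¹

  ι-∑≤ : ∀ n m (k : ℕ → ℕ) → (∀ d .{{_ : ℕ.NonZero d}} → d ℕ.* k d ℕ.≤ n) → ι (∑ m k) ≤ ι n * H m
  ι-∑≤ n zero    k dk≤n = ≤-reflexive (sym (zeroʳ (ι n)))
  ι-∑≤ n (suc m) k dk≤n = begin
    ι (∑ m k ℕ.+ k (suc m))                ≈⟨ ι-+ (∑ m k) (k (suc m)) ⟩
    ι (∑ m k) + ι (k (suc m))
      ≤⟨ +-mono-≤ (ι-∑≤ n m k dk≤n) (x*z≤y⇒x≤y/z (0<ι (suc m)) k*d≤n) ⟩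
    ι n * H m + ι n * ι (suc m) ⁻¹         ≈⟨ distribˡ (ι n) (H m) (ι (suc m) ⁻¹) ⟨
    ι n * H (suc m)                        ∎
    where
    open ≤-Reasoning
    k*d≤n : ι (k (suc m)) * ι (suc m) ≤ ι n
    k*d≤n = begin
      ι (k (suc m)) * ι (suc m)  ≈⟨ *-comm _ _ ⟩
      ι (suc m) * ι (k (suc m))  ≈⟨ ι-* (suc m) (k (suc m)) ⟨
      ι (suc m ℕ.* k (suc m))    ≤⟨ ι-mono (dk≤n (suc m)) ⟩
      ι n                        ∎

  -- All partition points are at least 1, so each summand is at most its increment, and the
  -- increments telescope. This bounds the lower sums, as `sup-upper` requires.
  lowerSum-≤ : ∀ m (t : Vector ℝ (suc m)) → (∀ i → t (inject₁ i) ≤ t (suc i)) → 1# ≤ t zero →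
               sum (λ i → (t (suc i) - t (inject₁ i)) / t (suc i)) + t zero ≤ t (fromℕ m)
  lowerSum-≤ zero    t mono 1≤t₀ = ≤-reflexive (+-identityˡ (t zero))
  lowerSum-≤ (suc m) t mono 1≤t₀ = begin
    (t₁ - t₀) / t₁ + S + t₀
      ≈⟨ solve 3 (λ a s t → a :+ s :+ t := s :+ (a :+ t)) refl ((t₁ - t₀) / t₁) S t₀ ⟩
    S + ((t₁ - t₀) / t₁ + t₀)
      ≤⟨ +-monoʳ-≤ S (+-monoˡ-≤ t₀ (*-monoˡ-≤ (x≤y⇒0≤y-x (mono zero)) (1≤x⇒x⁻¹≤1 1≤t₁))) ⟩
    S + ((t₁ - t₀) * 1# + t₀)     ≈⟨ +-congˡ (trans (+-congʳ (*-identityʳ _)) (x-y+y≈x t₁ t₀)) ⟩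
    S + t₁                        ≤⟨ lowerSum-≤ m (t ∘ suc) (mono ∘ suc) 1≤t₁ ⟩
    t (fromℕ (suc m))             ∎
    where
    open ≤-Reasoning
    t₀ t₁ S : ℝ
    t₀ = t zero
    t₁ = t (suc zero)
    S = sum (λ i → (t (suc (suc i)) - t (inject₁ (suc i))) / t (suc (suc i)))
    1≤t₁ : 1# ≤ t₁
    1≤t₁ = ≤-trans 1≤t₀ (mono zero)

  lowerSum-≤-ln : ∀ {x m} (p : Partition 1# x m) → lowerSum p ≤ ln x
  lowerSum-≤-ln {x} p = sup-upper LowerSum (lowerSum p , _ , p , refl) (x , bounded) (_ , p , refl)
    where
    LowerSum : Pred ℝ 0ℓ
    LowerSum y = ∃₂ λ m (p : Partition 1# x m) → y ≈ lowerSum p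
    bounded : IsUpperBound LowerSum x
    bounded {y} (m , p , y≈) = begin
      y                             ≈⟨ y≈ ⟩
      lowerSum p                    ≤⟨ x≤x+y (≤-trans 0≤1 1≤t₀) ⟩
      lowerSum p + point p zero     ≤⟨ lowerSum-≤ m (point p) (monotone p) 1≤t₀ ⟩
      point p (fromℕ m)             ≈⟨ end p ⟩
      x                             ∎
      where
      open ≤-Reasoning
      1≤t₀ : 1# ≤ point p zero
      1≤t₀ = ≤-reflexive (sym (Partition.start p))

  -- `sum` unfolds at the front, whereas `H` grows at the end.
  sum-toℕ : ∀ m (f : ℕ → ℝ) → sum {suc m} (f ∘ toℕ) ≈ sum {m} (f ∘ toℕ) + f m
  sum-toℕ zero    f = +-comm (f 0) 0#
  sum-toℕ (suc m) f = trans (+-congˡ (sum-toℕ m (f ∘ suc))) (sym (+-assoc (f 0) _ (f (suc m))))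

  module _ (m : ℕ) where

    S : ℝ
    S = sum {m} (λ i → ι (2 ℕ.+ toℕ i) ⁻¹)

    -- Unit steps make the lower sum the harmonic number of `suc m` without its leading 1.
    integers : Partition 1# (ι (suc m)) m
    integers = record
      { point    = λ i → ι (suc (toℕ i))
      ; start    = ι-1
      ; end      = reflexive (≡.cong (ι ∘ suc) (toℕ-fromℕ m))
      ; monotone = λ i → ι-mono (ℕ.s≤s (ℕ.≤-trans (ℕ.≤-reflexive (toℕ-inject₁ i)) (ℕ.n≤1+n (toℕ i))))
      }

    lowerSum-integers : lowerSum integers ≈ S
    lowerSum-integers = sum-cong-≋ {m} λ i → trans (*-congʳ (trans
      (+-congˡ (-‿cong (reflexive (≡.cong (ι ∘ suc) (toℕ-inject₁ i)))))
      (x+y-y≈x 1# (ι (suc (toℕ i)))))) (*-identityˡ _)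

    S≤ln : S ≤ ln (ι (suc m))
    S≤ln = ≤-respˡ-≈ lowerSum-integers (lowerSum-≤-ln integers)

  H≤1+S : ∀ m → H (suc m) ≤ 1# + S m
  H≤1+S zero    = begin
    0# + ι 1 ⁻¹  ≈⟨ +-identityˡ (ι 1 ⁻¹) ⟩
    ι 1 ⁻¹       ≤⟨ 1≤x⇒x⁻¹≤1 (1≤ι ℕ.≤-refl) ⟩
    1#           ≈⟨ +-identityʳ 1# ⟨
    1# + 0#      ∎
    where open ≤-Reasoning
  H≤1+S (suc m) = begin
    H (suc m) + ι (2 ℕ.+ m) ⁻¹      ≤⟨ +-monoˡ-≤ _ (H≤1+S m) ⟩
    1# + S m + ι (2 ℕ.+ m) ⁻¹       ≈⟨ +-assoc 1# (S m) _ ⟩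
    1# + (S m + ι (2 ℕ.+ m) ⁻¹)     ≈⟨ +-congˡ (sum-toℕ m (λ k → ι (2 ℕ.+ k) ⁻¹)) ⟨
    1# + S (suc m)                  ∎
    where open ≤-Reasoning

  sum-nonneg : ∀ m (f : Fin m → ℝ) → (∀ i → 0# ≤ f i) → 0# ≤ sum f
  sum-nonneg zero    f 0≤f = ≤-refl
  sum-nonneg (suc m) f 0≤f = 0≤x+y (0≤f zero) (sum-nonneg m (f ∘ suc) (0≤f ∘ suc))

  -- The leading 1 of the harmonic number is not part of the lower sum `S′`. For n ≥ 2, however,
  -- `S′` contains the term 1/2, so 1 ≤ 2 S′ and the total is at most 3 S′.
  H≤3ln : ∀ {n} → 2 ℕ.≤ n → H n ≤ ι 3 * ln (ι n)
  H≤3ln {suc (suc m)} (ℕ.s≤s (ℕ.s≤s _)) = begin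
    H (2 ℕ.+ m)                ≤⟨ H≤1+S (suc m) ⟩
    1# + S′                    ≤⟨ +-monoˡ-≤ S′ 1≤2S ⟩
    ι 2 * S′ + S′              ≈⟨ solve 2 (λ t s → t :* s :+ s := (con 1 :+ t) :* s) refl (ι 2) S′ ⟩
    ι 3 * S′                   ≤⟨ *-monoˡ-≤ (0≤ι 3) (S≤ln (suc m)) ⟩
    ι 3 * ln (ι (2 ℕ.+ m))     ∎
    where
    open ≤-Reasoning
    S′ : ℝ
    S′ = S (suc m)
    1≤2S : 1# ≤ ι 2 * S′
    1≤2S = begin
      1#            ≈⟨ x*x⁻¹≈1 (0<ι 2) ⟨
      ι 2 * ι 2 ⁻¹  ≤⟨ *-monoˡ-≤ (0≤ι 2) (x≤x+y (sum-nonneg m _ λ i → x⁻¹-nonneg (0<ι (3 ℕ.+ toℕ i)))) ⟩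
      ι 2 * S′      ∎

  0≤ln : ∀ {n} → 1 ℕ.≤ n → 0# ≤ ln (ι n)
  0≤ln {suc m} _ = ≤-trans (sum-nonneg m _ λ i → x⁻¹-nonneg (0<ι (2 ℕ.+ toℕ i))) (S≤ln m)

  ι-∑τ≤ : ∀ {n} → 2 ℕ.≤ n → ι (∑ n τ) ≤ ι n * (ι 3 * ln (ι n))
  ι-∑τ≤ {n} 2≤n = begin
    ι (∑ n τ)                     ≤⟨ ι-mono (∑τ-≤ n) ⟩
    ι (∑ n (multiplesUpTo n))     ≤⟨ ι-∑≤ n n (multiplesUpTo n) (λ d → *-multiplesUpTo n d) ⟩
    ι n * H n                     ≤⟨ *-monoˡ-≤ (0≤ι n) (H≤3ln 2≤n) ⟩
    ι n * (ι 3 * ln (ι n))        ∎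
    where open ≤-Reasoning

-- Rounding a real corner `α` to a vector of integers

∏-replicate : ∀ r n → ∏ (replicate r n) ≡ n ℕ.^ r
∏-replicate zero    n = ≡.refl
∏-replicate (suc r) n = ≡.cong (n ℕ.*_) (∏-replicate r n)

replicate-≤ : ∀ r n → All (_≤ℕ n) (replicate r n)
replicate-≤ zero    n = []
replicate-≤ (suc r) n = ℕ.≤-refl ∷ replicate-≤ r n

coprimeCount-≤ : ∀ {r} u (ms : Vec ℕ r) → coprimeCount u ms ≤ℕ ∏ ms
coprimeCount-≤ u []       = ℕ.≤-refl
coprimeCount-≤ u (m ∷ ms) = ℕ.≤-trans
  (∑-mono m λ x → ℕ.≤-trans (ℕ.*-mono-≤ (𝟙≤1 (coprime? u x)) (coprimeCount-≤ (u ℕ.* x) ms)) (ℕ.≤-reflexive (ℕ.*-identityˡ (∏ ms))))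
  (ℕ.≤-reflexive (∑-const m (∏ ms)))

module Discrepancy (𝓡 : CompleteOrderedField) where
  open Real 𝓡
  open OrderedField 𝓡
  open Logarithm 𝓡
  open Algebra.Properties.AbelianGroup +-abelianGroup using (⁻¹-anti-homo‿-)
  open Algebra.Properties.CommutativeSemiring.Exp commutativeSemiring using (^-distrib-*)

  ι-reflects-≤ : ∀ {m n} → ι m ≤ ι n → m ≤ℕ n
  ι-reflects-≤ {m} {n} ιm≤ιn with ℕ.≤-<-connex m n
  ... | inj₁ m≤n = m≤n
  ... | inj₂ n<m = contradiction (+-cancelʳ-≤ (ι n) (begin
    1# + ι n    ≤⟨ ι-mono n<m ⟩
    ι m         ≤⟨ ιm≤ιn ⟩
    ι n         ≈⟨ +-identityˡ (ι n) ⟨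
    0# + ι n    ∎)) 1≰0
    where open ≤-Reasoning

  -- A downward search from the cap `n`. The cap loses nothing, because the argument will be
  -- `ι n * α j` with `α j` at most 1.
  floor : ℕ → ℝ → ℕ
  floor zero    y = 0
  floor (suc n) y with ι (suc n) ≤? y
  ... | yes _ = suc n
  ... | no  _ = floor n y

  floor-≤ : ∀ n y → floor n y ≤ℕ n
  floor-≤ zero    y = ℕ.z≤n
  floor-≤ (suc n) y with ι (suc n) ≤? y
  ... | yes _ = ℕ.≤-refl
  ... | no  _ = ℕ.m≤n⇒m≤1+n (floor-≤ n y)

  floor-greatest : ∀ n {y} x → x ≤ℕ n → ι x ≤ y → x ≤ℕ floor n y
  floor-greatest zero        x x≤n   ιx≤y = x≤n
  floor-greatest (suc n) {y} x x≤1+n ιx≤y with ι (suc n) ≤? y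
  ... | yes _ = x≤1+n
  ... | no ¬p with ℕ.m≤n⇒m<n∨m≡n x≤1+n
  ... | inj₁ x<1+n  = floor-greatest n x (ℕ.≤-pred x<1+n) ιx≤y
  ... | inj₂ ≡.refl = contradiction ιx≤y ¬p

  ι-floor-≤ : ∀ n {y} → 0# ≤ y → ι (floor n y) ≤ y
  ι-floor-≤ zero        0≤y = 0≤y
  ι-floor-≤ (suc n) {y} 0≤y with ι (suc n) ≤? y
  ... | yes ι≤y = ι≤y
  ... | no  _   = ι-floor-≤ n 0≤y

  ≤-1+ι-floor : ∀ n {y} → y ≤ ι n → y ≤ 1# + ι (floor n y)
  ≤-1+ι-floor zero        y≤ = ≤-trans y≤ (≤-respʳ-≈ (sym (+-identityʳ 1#)) 0≤1)
  ≤-1+ι-floor (suc n) {y} y≤ with ι (suc n) ≤? y | total y (ι n)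
  ... | yes _ | _          = ≤-trans y≤ (≤-respˡ-≈ (+-identityˡ _) (+-monoˡ-≤ (ι (suc n)) 0≤1))
  ... | no  _ | inj₁ y≤ιn  = ≤-1+ι-floor n y≤ιn
  ... | no  _ | inj₂ ιn≤y  = ≤-trans y≤ (+-monoʳ-≤ 1# (ι-mono (floor-greatest n n ℕ.≤-refl ιn≤y)))

  G≡coprimeCount : ∀ {r} n (α : Vector ℝ r) ms → All (_≤ℕ n) ms →
    (∀ j x → ι x ≤ ι n * α j → x ≤ℕ lookup ms j) → (∀ j x → x ≤ℕ lookup ms j → ι x ≤ ι n * α j) →
    G n α ≡ coprimeCount 1 ms
  G≡coprimeCount n α ms ms≤n ⇒≤ ≤⇒ = length-filter≡coprimeCount n 1 ms ms≤n (counted? n α)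
    (λ x ((1≤x , x⊥x) , x≤nα) → pairwise⇒admissible
      (λ i → 1≤x i , ⇒≤ i (lookup x i) (x≤nα i)) (λ i → ∣1⇒≡1 ∘ proj₁)
      (λ i j i≢j → gcd≡1⇒coprime (x⊥x i j i≢j)))
    (λ x adm → ((λ i → proj₁ (admissible⇒bounds adm i))
              , (λ i j i≢j → coprime⇒gcd≡1 (admissible⇒pairwise adm i j i≢j)))
              , (λ i → ≤⇒ i (lookup x i) (proj₂ (admissible⇒bounds adm i))))

  floors : ∀ {r} → ℕ → Vector ℝ r → Vec ℕ r
  floors n α = tabulate (λ j → floor n (ι n * α j))

  module _ (n : ℕ) where

    floors-≤ : ∀ {r} (α : Vector ℝ r) → All (_≤ℕ n) (floors n α)
    floors-≤ α = tabulate⁺ (λ j → floor-≤ n (ι n * α j))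

    0≤nα : ∀ {x} → 0# ≤ x → 0# ≤ ι n * x
    0≤nα = *-nonneg (0≤ι n)

    nα≤n : ∀ {x} → x ≤ 1# → ι n * x ≤ ι n
    nα≤n x≤1 = ≤-respʳ-≈ (*-identityʳ (ι n)) (*-monoˡ-≤ (0≤ι n) x≤1)

    G≡coprimeCount-floors : ∀ {r} (α : Vector ℝ r) → InUnitCube α → G n α ≡ coprimeCount 1 (floors n α)
    G≡coprimeCount-floors α cube = G≡coprimeCount n α (floors n α) (floors-≤ α)
      (λ j x ιx≤ → ≡.subst (x ≤ℕ_) (≡.sym (lookup∘tabulate _ j))
        (floor-greatest n x (ι-reflects-≤ (≤-trans ιx≤ (nα≤n (proj₂ (cube j))))) ιx≤))
      (λ j x x≤ → ≤-trans (ι-mono (≡.subst (x ≤ℕ_) (lookup∘tabulate _ j) x≤))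
        (ι-floor-≤ n (0≤nα (proj₁ (cube j)))))

    G-𝟏 : ∀ r → G {r} n 𝟏 ≡ coprimeCount 1 (replicate r n)
    G-𝟏 r = G≡coprimeCount n 𝟏 (replicate r n) (replicate-≤ r n)
      (λ j x ιx≤ → ≡.subst (x ≤ℕ_) (≡.sym (lookup-replicate j n)) (ι-reflects-≤ (≤-respʳ-≈ (*-identityʳ (ι n)) ιx≤)))
      (λ j x x≤ → ≤-respʳ-≈ (sym (*-identityʳ (ι n))) (ι-mono (≡.subst (x ≤ℕ_) (lookup-replicate j n) x≤)))

    ∏-floors-≤ : ∀ {r} (α : Vector ℝ r) → InUnitCube α → ι (∏ (floors n α)) ≤ ι (n ℕ.^ r) * volume α
    ∏-floors-≤ {zero}  α cube = ≤-reflexive (sym (*-identityʳ (ι 1)))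
    ∏-floors-≤ {suc r} α cube = begin
      ι (m ℕ.* ∏ ms)                                   ≈⟨ ι-* m (∏ ms) ⟩
      ι m * ι (∏ ms)
        ≤⟨ *-mono-≤ (0≤ι (∏ ms)) (0≤nα 0≤α₀) (ι-floor-≤ n (0≤nα 0≤α₀)) (∏-floors-≤ (α ∘ suc) (cube ∘ suc)) ⟩
      ι n * α zero * (ι (n ℕ.^ r) * volume (α ∘ suc))
        ≈⟨ solve 4 (λ a b c d → a :* b :* (c :* d) := a :* c :* (b :* d)) refl (ι n) (α zero) (ι (n ℕ.^ r)) (volume (α ∘ suc)) ⟩
      ι n * ι (n ℕ.^ r) * volume α                     ≈⟨ *-congʳ (ι-* n (n ℕ.^ r)) ⟨
      ι (n ℕ.^ suc r) * volume α                       ∎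
      where
      open ≤-Reasoning
      0≤α₀ : 0# ≤ α zero
      0≤α₀ = proj₁ (cube zero)
      m : ℕ
      m = floor n (ι n * α zero)
      ms : Vec ℕ r
      ms = floors n (α ∘ suc)

    -- Rounding one factor loses less than 1 or exactly nothing, while the others are at most `n`;
    -- so the whole loss is at most r n^(r-1). The extra factor `n` on both sides avoids the
    -- exponent r - 1.
    ≤-∏-floors : ∀ {r} (α : Vector ℝ r) → InUnitCube α →
                 ι n * (ι (n ℕ.^ r) * volume α) ≤ ι (n ℕ.* ∏ (floors n α) ℕ.+ r ℕ.* n ℕ.^ r)
    ≤-∏-floors {zero}  α cube = ≤-reflexive (trans (*-congˡ (*-identityʳ (ι 1)))
      (trans (sym (ι-* n 1)) (reflexive (≡.cong ι (≡.sym (ℕ.+-identityʳ (n ℕ.* 1)))))))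
    ≤-∏-floors {suc r} α cube = begin
      N * (ι (n ℕ.^ suc r) * volume α)
        ≈⟨ *-congˡ (*-congʳ (ι-* n (n ℕ.^ r))) ⟩
      N * (N * M * (α zero * v))
        ≈⟨ solve 4 (λ N M a v → N :* (N :* M :* (a :* v)) := N :* a :* (N :* (M :* v))) refl N M (α zero) v ⟩
      N * α zero * (N * (M * v))
        ≤⟨ *-monoˡ-≤ (0≤nα (proj₁ (cube zero))) (≤-∏-floors (α ∘ suc) (cube ∘ suc)) ⟩
      N * α zero * ι (n ℕ.* ∏ ms ℕ.+ r ℕ.* n ℕ.^ r)
        ≈⟨ trans (*-congˡ (ι-+ (n ℕ.* ∏ ms) (r ℕ.* n ℕ.^ r))) (distribˡ _ _ _) ⟩
      N * α zero * ι (n ℕ.* ∏ ms) + N * α zero * ι (r ℕ.* n ℕ.^ r)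
        ≤⟨ +-mono-≤ (*-monoʳ-≤ (0≤ι (n ℕ.* ∏ ms)) (≤-1+ι-floor n (nα≤n (proj₂ (cube zero)))))
                    (*-monoʳ-≤ (0≤ι (r ℕ.* n ℕ.^ r)) (nα≤n (proj₂ (cube zero)))) ⟩
      ι (suc m) * ι (n ℕ.* ∏ ms) + N * ι (r ℕ.* n ℕ.^ r)
        ≈⟨ +-cong (ι-* (suc m) (n ℕ.* ∏ ms)) (ι-* n (r ℕ.* n ℕ.^ r)) ⟨
      ι (suc m ℕ.* (n ℕ.* ∏ ms)) + ι (n ℕ.* (r ℕ.* n ℕ.^ r))
        ≈⟨ ι-+ (suc m ℕ.* (n ℕ.* ∏ ms)) (n ℕ.* (r ℕ.* n ℕ.^ r)) ⟨
      ι (suc m ℕ.* (n ℕ.* ∏ ms) ℕ.+ n ℕ.* (r ℕ.* n ℕ.^ r))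
        ≤⟨ ι-mono (ℕ.+-monoˡ-≤ (n ℕ.* (r ℕ.* n ℕ.^ r)) (ℕ.+-monoˡ-≤ (m ℕ.* (n ℕ.* ∏ ms)) (ℕ.*-monoʳ-≤ n (∏-≤ (floors-≤ (α ∘ suc)))))) ⟩
      ι (n ℕ.* n ℕ.^ r ℕ.+ m ℕ.* (n ℕ.* ∏ ms) ℕ.+ n ℕ.* (r ℕ.* n ℕ.^ r))
        ≈⟨ reflexive (≡.cong ι (collect n (n ℕ.^ r) m (∏ ms) r)) ⟩
      ι (n ℕ.* (m ℕ.* ∏ ms) ℕ.+ suc r ℕ.* (n ℕ.* n ℕ.^ r)) ∎
      where
      open ≤-Reasoning
      N M v : ℝ
      N = ι n
      M = ι (n ℕ.^ r)
      v = volume (α ∘ suc)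
      m : ℕ
      m = floor n (ι n * α zero)
      ms : Vec ℕ r
      ms = floors n (α ∘ suc)
      collect : ∀ n M m p r → n ℕ.* M ℕ.+ m ℕ.* (n ℕ.* p) ℕ.+ n ℕ.* (r ℕ.* M) ≡
        n ℕ.* (m ℕ.* p) ℕ.+ suc r ℕ.* (n ℕ.* M)
      collect = solve-∀

  -- The two bounds for the discrepancy

  c : ℝ
  c = ι 2 ⁻¹

  c≤1 : c ≤ 1#
  c≤1 = 1≤x⇒x⁻¹≤1 (1≤ι {2} (ℕ.s≤s ℕ.z≤n))

  1≰c : ¬ 1# ≤ c
  1≰c 1≤c = ℕ.1+n≰n (ι-reflects-≤ {2} {1} (begin
    ι 2       ≈⟨ *-identityʳ (ι 2) ⟨
    ι 2 * 1#  ≤⟨ *-monoˡ-≤ (0≤ι 2) 1≤c ⟩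
    ι 2 * c   ≈⟨ x*x⁻¹≈1 (0<ι 2) ⟩
    1#        ≈⟨ ι-1 ⟨
    ι 1       ∎))
    where open ≤-Reasoning

  volume-𝟏 : ∀ r → volume {r} 𝟏 ≈ 1#
  volume-𝟏 zero    = refl
  volume-𝟏 (suc r) = trans (*-identityˡ _) (volume-𝟏 r)

  -- With r = k + 1, the factor 3 r collects the counting error 2 r and the rounding error r;
  -- `3 ^ k` comes from `H≤3ln`, and `B` from the density. The `suc` makes the constant at least 1,
  -- hence larger than `c`.
  upperConstant : ℕ → ℕ
  upperConstant k = suc (3 ℕ.* suc k ℕ.* 3 ℕ.^ k ℕ.* Density.B (suc k))

  module Estimate (n : ℕ) (2≤n : 2 ≤ℕ n) (k : ℕ) where

    r B C : ℕ
    r = suc k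
    B = Density.B r
    C = upperConstant k

    1≤n : 1 ≤ℕ n
    1≤n = ℕ.≤-trans (ℕ.n≤1+n 1) 2≤n

    instance
      n≢0 : ℕ.NonZero n
      n≢0 = ℕ.>-nonZero 1≤n
      nʳ≢0 : ℕ.NonZero (n ℕ.^ r)
      nʳ≢0 = ℕ.m^n≢0 n r

    Γ₁ T : ℕ
    Γ₁ = coprimeCount 1 (replicate r n)
    T  = ∑ n τ

    instance
      Γ₁≢0 : ℕ.NonZero Γ₁
      Γ₁≢0 = ℕ.>-nonZero (1≤coprimeCount r n 1≤n 1)

    N M L Y g₁ : ℝ
    N = ι n
    M = ι (n ℕ.^ r)
    L = ln N
    Y = ι C * (L ^ k / N)
    g₁ = ι Γ₁

    -- Multiplication by `N` completes the power `N ^ k` to `n ^ r`, which `coprimeCount-large`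
    -- trades for `B * Γ₁`. Undoing it gives the denominator of `Y`.
    error-≤ : ι (3 ℕ.* r ℕ.* T ℕ.^ k) ≤ Y * g₁
    error-≤ = *-cancelˡ-≤ (0<ι n) (begin
      N * ι (3 ℕ.* r ℕ.* T ℕ.^ k)
        ≈⟨ *-congˡ (trans (ι-* (3 ℕ.* r) (T ℕ.^ k)) (*-congˡ (ι-^ T k))) ⟩
      N * (ι (3 ℕ.* r) * ι T ^ k)
        ≤⟨ *-monoˡ-≤ (0≤ι n) (*-monoˡ-≤ (0≤ι (3 ℕ.* r)) (^-mono-≤ k (0≤ι T) (ι-∑τ≤ 2≤n))) ⟩
      N * (ι (3 ℕ.* r) * (N * (ι 3 * L)) ^ k)
        ≈⟨ *-congˡ (*-congˡ (trans (^-distrib-* N (ι 3 * L) k) (*-congˡ (^-distrib-* (ι 3) L k)))) ⟩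
      N * (ι (3 ℕ.* r) * (N ^ k * (ι 3 ^ k * L ^ k)))
        ≈⟨ solve 5 (λ a b c d e → a :* (b :* (c :* (d :* e))) := b :* d :* (a :* c) :* e) refl N (ι (3 ℕ.* r)) (N ^ k) (ι 3 ^ k) (L ^ k) ⟩
      ι (3 ℕ.* r) * ι 3 ^ k * N ^ r * L ^ k
        ≈⟨ *-congʳ (*-cong (trans (ι-* (3 ℕ.* r) (3 ℕ.^ k)) (*-congˡ (ι-^ 3 k))) (ι-^ n r)) ⟨
      ι (3 ℕ.* r ℕ.* 3 ℕ.^ k) * M * L ^ k
        ≈⟨ *-congʳ (ι-* (3 ℕ.* r ℕ.* 3 ℕ.^ k) (n ℕ.^ r)) ⟨
      ι (3 ℕ.* r ℕ.* 3 ℕ.^ k ℕ.* n ℕ.^ r) * L ^ k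
        ≤⟨ *-monoʳ-≤ (^-nonneg k (0≤ln 1≤n)) (ι-mono counts) ⟩
      ι (C ℕ.* Γ₁) * L ^ k
        ≈⟨ *-congʳ (ι-* C Γ₁) ⟩
      ι C * g₁ * L ^ k
        ≈⟨ *-congˡ (x*y*y⁻¹≈x (L ^ k) (0<ι n)) ⟨
      ι C * g₁ * (L ^ k * N * N ⁻¹)
        ≈⟨ solve 5 (λ c g l n n⁻¹ → c :* g :* (l :* n :* n⁻¹) := n :* (c :* (l :* n⁻¹) :* g)) refl (ι C) g₁ (L ^ k) N (N ⁻¹) ⟩
      N * (Y * g₁) ∎)
      where
      open ≤-Reasoning
      counts : 3 ℕ.* r ℕ.* 3 ℕ.^ k ℕ.* n ℕ.^ r ≤ℕ C ℕ.* Γ₁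
      counts = ℕ.≤-trans (ℕ.*-monoʳ-≤ (3 ℕ.* r ℕ.* 3 ℕ.^ k) (Density.coprimeCount-large r n 1≤n))
        (ℕ.≤-trans (ℕ.≤-reflexive (≡.sym (ℕ.*-assoc (3 ℕ.* r ℕ.* 3 ℕ.^ k) B Γ₁))) (ℕ.*-monoˡ-≤ Γ₁ (ℕ.n≤1+n (3 ℕ.* r ℕ.* 3 ℕ.^ k ℕ.* B))))

    module _ (α : Vector ℝ r) (cube : InUnitCube α) where

      ms : Vec ℕ r
      ms = floors n α

      Γ : ℕ
      Γ = coprimeCount 1 ms

      g v A : ℝ
      g = ι Γ
      v = volume α
      A = ι (∏ ms)

      E : ℕ
      E = 2 ℕ.* r ℕ.* T ℕ.^ k

      ι-error : ∀ a b → ι (a ℕ.* b ℕ.+ n ℕ.^ r ℕ.* E) ≈ ι a * ι b + M * ι E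
      ι-error a b = trans (ι-+ (a ℕ.* b) (n ℕ.^ r ℕ.* E)) (+-cong (ι-* a b) (ι-* (n ℕ.^ r) E))

      rearrange : ∀ r M t → r ℕ.* (2 ℕ.* M ℕ.* 1 ℕ.* t) ≡ M ℕ.* (2 ℕ.* r ℕ.* t)
      rearrange = solve-∀

      count-upper : g ≤ v * g₁ + ι E
      count-upper = *-cancelˡ-≤ (0<ι (n ℕ.^ r)) (begin
        M * g                                   ≈⟨ ι-* (n ℕ.^ r) Γ ⟨
        ι (n ℕ.^ r ℕ.* Γ)                       ≤⟨ ι-mono counts ⟩
        ι (∏ ms ℕ.* Γ₁ ℕ.+ n ℕ.^ r ℕ.* E)       ≈⟨ ι-error (∏ ms) Γ₁ ⟩
        A * g₁ + M * ι E
          ≤⟨ +-monoˡ-≤ (M * ι E) (*-monoʳ-≤ (0≤ι Γ₁) (∏-floors-≤ n α cube)) ⟩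
        M * v * g₁ + M * ι E
          ≈⟨ solve 4 (λ M v g e → M :* v :* g :+ M :* e := M :* (v :* g :+ e)) refl M v g₁ (ι E) ⟩
        M * (v * g₁ + ι E)                      ∎)
        where
        open ≤-Reasoning
        counts : n ℕ.^ r ℕ.* Γ ≤ℕ ∏ ms ℕ.* Γ₁ ℕ.+ n ℕ.^ r ℕ.* E
        counts = ≡.subst₂ (λ p e → p ℕ.* Γ ≤ℕ ∏ ms ℕ.* Γ₁ ℕ.+ e) (∏-replicate r n) (rearrange r (n ℕ.^ r) (T ℕ.^ k))
          (coprimeCount-discrepancy {n = n} {1} {1} equidistributed-1 (floors-≤ n α) (replicate-≤ r n))

      -- Unlike in `count-upper`, rounding down now works against the inequality and costs r n^r Γ₁.
      -- As Γ₁ ≤ n^r ≤ n T^k, this adds one more r T^k to the 2 r T^k of `E`.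
      count-lower : v * g₁ ≤ g + ι (3 ℕ.* r ℕ.* T ℕ.^ k)
      count-lower = *-cancelˡ-≤ (*-pos (0<ι n) (0<ι (n ℕ.^ r))) (begin
        N * M * (v * g₁)
          ≈⟨ solve 4 (λ N M v g → N :* M :* (v :* g) := N :* (M :* v) :* g) refl N M v g₁ ⟩
        N * (M * v) * g₁
          ≤⟨ *-monoʳ-≤ (0≤ι Γ₁) (≤-∏-floors n α cube) ⟩
        ι (n ℕ.* ∏ ms ℕ.+ r ℕ.* n ℕ.^ r) * g₁
          ≈⟨ ι-* (n ℕ.* ∏ ms ℕ.+ r ℕ.* n ℕ.^ r) Γ₁ ⟨
        ι ((n ℕ.* ∏ ms ℕ.+ r ℕ.* n ℕ.^ r) ℕ.* Γ₁)
          ≤⟨ ι-mono counts ⟩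
        ι (n ℕ.* n ℕ.^ r ℕ.* (Γ ℕ.+ 3 ℕ.* r ℕ.* T ℕ.^ k))
          ≈⟨ trans (ι-* (n ℕ.* n ℕ.^ r) (Γ ℕ.+ 3 ℕ.* r ℕ.* T ℕ.^ k)) (*-cong (ι-* n (n ℕ.^ r)) (ι-+ Γ (3 ℕ.* r ℕ.* T ℕ.^ k))) ⟩
        N * M * (g + ι (3 ℕ.* r ℕ.* T ℕ.^ k)) ∎)
        where
        open ≤-Reasoning
        expand : ∀ n p r M G → (n ℕ.* p ℕ.+ r ℕ.* M) ℕ.* G ≡ n ℕ.* (p ℕ.* G) ℕ.+ r ℕ.* M ℕ.* G
        expand = solve-∀
        collect : ∀ n M G r t → n ℕ.* (M ℕ.* G ℕ.+ r ℕ.* (2 ℕ.* M ℕ.* 1 ℕ.* t)) ℕ.+ r ℕ.* M ℕ.* (n ℕ.* t) ≡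
          n ℕ.* M ℕ.* (G ℕ.+ 3 ℕ.* r ℕ.* t)
        collect = solve-∀
        main : ∏ ms ℕ.* Γ₁ ≤ℕ n ℕ.^ r ℕ.* Γ ℕ.+ r ℕ.* (2 ℕ.* n ℕ.^ r ℕ.* 1 ℕ.* T ℕ.^ k)
        main = ≡.subst (λ p → ∏ ms ℕ.* Γ₁ ≤ℕ p ℕ.* Γ ℕ.+ r ℕ.* (2 ℕ.* n ℕ.^ r ℕ.* 1 ℕ.* T ℕ.^ k)) (∏-replicate r n)
          (coprimeCount-discrepancy {n = n} {1} {1} equidistributed-1 (replicate-≤ r n) (floors-≤ n α))
        Γ₁≤ : Γ₁ ≤ℕ n ℕ.* T ℕ.^ k
        Γ₁≤ = ℕ.≤-trans (coprimeCount-≤ 1 (replicate r n)) (ℕ.≤-trans (ℕ.≤-reflexive (∏-replicate r n))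
          (ℕ.*-monoʳ-≤ n (ℕ.^-monoˡ-≤ k (n≤∑τ n))))
        counts : (n ℕ.* ∏ ms ℕ.+ r ℕ.* n ℕ.^ r) ℕ.* Γ₁ ≤ℕ n ℕ.* n ℕ.^ r ℕ.* (Γ ℕ.+ 3 ℕ.* r ℕ.* T ℕ.^ k)
        counts = ℕ.≤-trans (ℕ.≤-reflexive (expand n (∏ ms) r (n ℕ.^ r) Γ₁))
          (ℕ.≤-trans (ℕ.+-mono-≤ (ℕ.*-monoʳ-≤ n main) (ℕ.*-monoʳ-≤ (r ℕ.* n ℕ.^ r) Γ₁≤))
            (ℕ.≤-reflexive (collect n (n ℕ.^ r) Γ r (T ℕ.^ k))))

      deviation-≤ : ∣ ι (G n α) / ι (G {r} n 𝟏) - v ∣ ≤ Y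
      deviation-≤ rewrite G≡coprimeCount-floors n α cube | G-𝟏 n r = ∣x∣≤y
        (x≤y+z⇒x-z≤y (x≤y*z⇒x/z≤y (0<ι Γ₁) (begin
          g                                ≤⟨ count-upper ⟩
          v * g₁ + ι E                     ≤⟨ +-monoʳ-≤ (v * g₁) (≤-trans (ι-mono E≤) error-≤) ⟩
          v * g₁ + Y * g₁
            ≈⟨ solve 3 (λ v Y g → v :* g :+ Y :* g := (Y :+ v) :* g) refl v Y g₁ ⟩
          (Y + v) * g₁                     ∎)))
        (≤-respˡ-≈ (sym (⁻¹-anti-homo‿- (g / g₁) v)) (x≤y+z⇒x-z≤y (begin
          v                                ≤⟨ x*z≤y⇒x≤y/z (0<ι Γ₁) (≤-trans count-lower (+-monoʳ-≤ g error-≤)) ⟩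
          (g + Y * g₁) / g₁                ≈⟨ distribʳ (g₁ ⁻¹) g (Y * g₁) ⟩
          g / g₁ + Y * g₁ / g₁             ≈⟨ +-congˡ (x*y*y⁻¹≈x Y (0<ι Γ₁)) ⟩
          g / g₁ + Y                       ≈⟨ +-comm _ _ ⟩
          Y + g / g₁                       ∎)))
        where
        open ≤-Reasoning
        E≤ : E ≤ℕ 3 ℕ.* r ℕ.* T ℕ.^ k
        E≤ = ℕ.*-monoˡ-≤ (T ℕ.^ k) (ℕ.*-monoˡ-≤ r (ℕ.n≤1+n 2))

    corner : Vector ℝ r
    corner zero    = c / N
    corner (suc _) = 1#

    0≤c/N : 0# ≤ c / N
    0≤c/N = *-nonneg (x⁻¹-nonneg (0<ι 2)) (x⁻¹-nonneg (0<ι n))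

    corner-inUnitCube : InUnitCube corner
    corner-inUnitCube zero    = 0≤c/N , x≤y*z⇒x/z≤y (0<ι n)
      (≤-respʳ-≈ (sym (*-identityˡ N)) (≤-trans c≤1 (1≤ι 1≤n)))
    corner-inUnitCube (suc _) = 0≤1 , ≤-refl

    N*c/N≈c : N * (c / N) ≈ c
    N*c/N≈c = trans (*-comm N (c / N)) (x/y*y≈x c (0<ι n))

    floor-corner : floor n (N * (c / N)) ≡ 0
    floor-corner = ℕ.n<1⇒n≡0 (ℕ.≰⇒> λ 1≤⌊c⌋ → 1≰c (begin
      1#                           ≤⟨ 1≤ι 1≤⌊c⌋ ⟩
      ι (floor n (N * (c / N)))    ≤⟨ ι-floor-≤ n (0≤nα n 0≤c/N) ⟩
      N * (c / N)                  ≈⟨ N*c/N≈c ⟩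
      c                            ∎))
      where open ≤-Reasoning

    G-corner : G n corner ≡ 0
    G-corner = ≡.trans (G≡coprimeCount-floors n corner corner-inUnitCube)
      -- With first bound 0 the outermost sum is empty and computes to 0.
      (≡.cong (λ m → coprimeCount 1 (m ∷ floors n (corner ∘ suc))) floor-corner)

    Deviation : Pred ℝ 0ℓ
    Deviation y = ∃ λ (α : Vector ℝ r) → InUnitCube α × y ≈ ∣ ι (G n α) / ι (G {r} n 𝟏) - volume α ∣

    cornerDeviation : ℝ
    cornerDeviation = ∣ ι (G n corner) / ι (G {r} n 𝟏) - volume corner ∣

    deviation-bounded : IsUpperBound Deviation Y
    deviation-bounded (α , cube , y≈) = ≤-respˡ-≈ (sym y≈) (deviation-≤ α cube)

    c/N≤cornerDeviation : c / N ≤ cornerDeviation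
    c/N≤cornerDeviation = begin
      c / N                                            ≈⟨ *-identityʳ (c / N) ⟨
      c / N * 1#                                       ≈⟨ *-congˡ (volume-𝟏 k) ⟨
      volume corner                                    ≈⟨ +-identityʳ (volume corner) ⟨
      volume corner + 0#
        ≈⟨ +-congˡ (trans (-‿cong (zeroˡ (ι (G {r} n 𝟏) ⁻¹))) -0≈0) ⟨
      volume corner - 0# / ι (G {r} n 𝟏)
        ≈⟨ +-congˡ (-‿cong (*-congʳ (reflexive (≡.cong ι G-corner)))) ⟨
      volume corner - ι (G n corner) / ι (G {r} n 𝟏)   ≈⟨ ⁻¹-anti-homo‿- _ (volume corner) ⟨
      - (ι (G n corner) / ι (G {r} n 𝟏) - volume corner) ≤⟨ -x≤∣x∣ _ ⟩
      cornerDeviation                                  ∎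
      where
      open ≤-Reasoning
      -0≈0 : - 0# ≈ 0#
      -0≈0 = trans (sym (+-identityˡ (- 0#))) (-‿inverseʳ 0#)

    satisfiable : ∃ Deviation
    satisfiable = cornerDeviation , corner , corner-inUnitCube , refl

    -- `sup` dominates its set only if the set is bounded, so the lower bound relies on the upper
    -- estimate as well.
    Δ-lower : c / N ≤ Δ-PC r n
    Δ-lower = ≤-trans c/N≤cornerDeviation
      (sup-upper Deviation satisfiable (Y , deviation-bounded) (corner , corner-inUnitCube , refl))

    Δ-upper : Δ-PC r n ≤ Y
    Δ-upper = sup-least Deviation satisfiable Y deviation-bounded

theorem4p2 : (𝓡 : CompleteOrderedField) → let open Real 𝓡 in
    ∀ (r : ℕ) → 2 ≤ℕ r →
    ∃₂ λ (c C : ℝ) → 0# < c × c < C ×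
    (∀ (n : ℕ) → 2 ≤ℕ n →
    c / ι n ≤ Δ-PC r n ×
    Δ-PC r n ≤ C * (ln (ι n) ^ (r ∸ℕ 1) / ι n))
theorem4p2 𝓡 (suc k) _ = c , ι (upperConstant k) , 0<c , c<C ,
    λ n 2≤n → Estimate.Δ-lower n 2≤n k , Estimate.Δ-upper n 2≤n k
  where
  open Real 𝓡
  open OrderedField 𝓡
  open Discrepancy 𝓡
  0<c : 0# < c
  0<c = x⁻¹-nonneg (0<ι 2) , λ 0≈c → 0≉1 (trans (sym (zeroʳ (ι 2))) (trans (*-congˡ 0≈c) (x*x⁻¹≈1 (0<ι 2))))
  1≤C : 1# ≤ ι (upperConstant k)
  1≤C = 1≤ι {upperConstant k} (ℕ.s≤s ℕ.z≤n)
  c<C : c < ι (upperConstant k)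
  c<C = ≤-trans c≤1 1≤C , λ c≈C → 1≰c (≤-respʳ-≈ (sym c≈C) 1≤C)
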